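{- There exists $n_0$ such that for every integer $n \geq n_0$ the following holds. Let $\varepsilon = \varepsilon(n) \geq 4 n^{ -1/4}$ and let $t = t(n) \leq \varepsilon^2 \sqrt{n}/5$ be a positive integer. If $q \leq (1-\varepsilon) n$ is a positive integer, then in the $(1:q)$ Waiter-Client game played on $E(K_n)$, Waiter has a strategy to force Client to build a graph which admits a $K_t$-minor. On the other hand, if $q \geq n + \eta$, where $\eta = \eta(n) \geq n^{2/3}\log n$, then in the $(1:q)$ Waiter-Client game played on $E(K_n)$, Client has a strategy to ensure that his graph is $K_4$-minor free throughout the game.
   Context: $\log$ denotes the natural logarithm. The $(1:q)$ Waiter-Client game on the board $X = E(K_n)$ (the edge set of the complete graph on $n$ vertices) is played as follows: in each round Waiter offers Client $q+1$ previously unoffered (free) edges; Client claims one of them and Waiter claims the remaining $q$. If in the final round only $1 \le r < q+1$ free edges remain, Client claims $\max\{0, r-q\}$ of them and Waiter claims the rest. The game ends when all edges are claimed. Client's graph is the graph on $V(K_n)$ formed by the edges Client claimed. A graph $G$ admits a $K_t$-minor if there exist pairwise disjoint vertex sets $B_1,\dots,B_t \subseteq V(G)$ such that each $G[B_i]$ is connected and for every $i<j$ there is an edge of $G$ between $B_i$ and $B_j$. -}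

module Defs where

open import Level using (0ℓ)
open import Data.Nat as ℕ using (ℕ; zero; suc)
open import Data.Integer using (+_)
open import Data.Rational as ℚ using (ℚ)
open import Data.Fin as Fin using (Fin)
open import Data.Fin.Properties as FinP using ()
open import Data.Maybe using (Maybe; just)
open import Data.Product using (Σ; ∃; ∃-syntax; _×_; _,_)
open import Data.Product.Properties using (≡-dec)
open import Data.Sum using (_⊎_)
open import Data.List using (List; []; _∷_; length; filter; cartesianProduct; allFin)
open import Data.List.Relation.Unary.Unique.Propositional using (Unique)
open import Relation.Binary.PropositionalEquality using (_≡_)
open import Relation.Binary using (DecidableEquality)
open import Relation.Nullary using (¬_)
open import Relation.Nullary using (¬?)
import Data.List.Membership.Propositional as MemP
import Data.List.Membership.DecPropositional as MemD

-- Edges of K_n: ordered pairs (i , j) of vertices with i < j.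

Edge : ℕ → Set
Edge n = Fin n × Fin n

_≟E_ : ∀ {n} → DecidableEquality (Edge n)
_≟E_ = ≡-dec FinP._≟_ FinP._≟_

open MemP public using (_∈_)

allEdges : (n : ℕ) → List (Edge n)
allEdges n = filter (λ e → Data.Product.proj₁ e Fin.<? Data.Product.proj₂ e)
                    (cartesianProduct (allFin n) (allFin n))

_∖_ : ∀ {n} → List (Edge n) → List (Edge n) → List (Edge n)
F ∖ S = filter (λ e → ¬? (e ∈? S)) F
  where open MemD _≟E_ using (_∈?_)

Adj : ∀ {n} → List (Edge n) → Fin n → Fin n → Set
Adj C u v = ((u , v) ∈ C) ⊎ ((v , u) ∈ C)

-- walks in G[Q] (all vertices after the first lie in Q)
data Walk {n} (C : List (Edge n)) (Q : Fin n → Set) : Fin n → Fin n → Set where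
  here : ∀ {u} → Walk C Q u u
  step : ∀ {u w v} → Adj C u w → Q w → Walk C Q w v → Walk C Q u v

-- K_t-minor: pairwise disjoint branch sets B_1..B_t (encoded by a partial map
-- vertex ↦ index of its branch set), each nonempty and inducing a connected
-- subgraph, with an edge between B_i and B_j for every i < j.
HasMinor : ∀ {n} (t : ℕ) → List (Edge n) → Set
HasMinor {n} t C =
  Σ (Fin n → Maybe (Fin t)) λ branch →
    let InB : Fin t → Fin n → Set
        InB i v = branch v ≡ just i
    in ((i : Fin t) → ∃[ v ] InB i v)
     × ((i : Fin t) (u v : Fin n) → InB i u → InB i v → Walk C (InB i) u v)
     × ((i j : Fin t) → i Fin.< j → ∃[ u ] ∃[ v ] (InB i u × InB j v × Adj C u v))

-- The (1:q) Waiter-Client game.  State: list F of free edges, list C of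
-- Client's edges.  A round: Waiter offers q+1 distinct free edges.

Offer : ∀ {n} (q : ℕ) → List (Edge n) → List (Edge n) → Set
Offer q F S = (length S ≡ suc q) × Unique S × (∀ e → e ∈ S → e ∈ F)

-- Waiter has a strategy guaranteeing that Client's final graph satisfies P.
-- When at most q free edges remain (final partial round, or game over),
-- Client gets max{0, r - q} = 0 of them, so Client's graph is final.
data WaiterWins {n} (q : ℕ) (P : List (Edge n) → Set) : List (Edge n) → List (Edge n) → Set where
  endW   : ∀ {F C} → length F ℕ.≤ q → P C → WaiterWins q P F C
  roundW : ∀ {F C} (S : List (Edge n)) → Offer q F S
         → (∀ e → e ∈ S → WaiterWins q P (F ∖ S) (e ∷ C)) → WaiterWins q P F C

data ClientWins {n} (q : ℕ) (P : List (Edge n) → Set) : List (Edge n) → List (Edge n) → Set where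
  endC   : ∀ {F C} → length F ℕ.≤ q → P C → ClientWins q P F C
  roundC : ∀ {F C} → suc q ℕ.≤ length F → P C
         → (∀ S → Offer q F S → ∃[ e ] (e ∈ S × ClientWins q P (F ∖ S) (e ∷ C)))
         → ClientWins q P F C

ℕ→ℚ : ℕ → ℚ
ℕ→ℚ k = + k ℚ./ 1

expTerm : ℚ → ℕ → ℚ
expTerm r zero    = ℚ.1ℚ
expTerm r (suc k) = expTerm r k ℚ.* r ℚ.* (+ 1 ℚ./ suc k)

expPartial : ℚ → ℕ → ℚ
expPartial r zero    = ℚ.1ℚ
expPartial r (suc K) = expPartial r K ℚ.+ expTerm r (suc K)

-- "n^{2/3} · log n ≤ η" (natural log), for η ≥ 0:
-- every rational r ≥ 0 with e^r ≤ n (i.e. r ≤ log n) satisfies r^3 n^2 ≤ η^3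
-- (i.e. r n^{2/3} ≤ η).  Here e^r ≤ n iff all partial sums of the
-- exponential series are ≤ n.
LogBound : ℕ → ℚ → Set
LogBound n η = (ℚ.0ℚ ℚ.≤ η) ×
  ((r : ℚ) → ℚ.0ℚ ℚ.≤ r → ((K : ℕ) → expPartial r K ℚ.≤ ℕ→ℚ n)
    → r ℚ.* r ℚ.* r ℚ.* ℕ→ℚ (n ℕ.* n) ℚ.≤ η ℚ.* η ℚ.* η)

module Submission where

open import Defs
open import Data.Nat as ℕ using (ℕ; zero; suc; _+_; _*_; _∸_; _^_; z≤n; s≤s; NonZero)
import Data.Nat.Properties as ℕP
open import Data.Nat.DivMod using (_/_; _%_; m≡m%n+[m/n]*n; m%n<n; m/n*n≤m; [m+kn]%n≡m%n; m%n%n≡m%n; /-monoˡ-≤)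
open import Data.Nat.Tactic.RingSolver using (solve-∀)
import Data.Integer as ℤ
import Data.Integer.Properties as ℤP
open import Data.Rational as ℚ using (ℚ; 0ℚ; 1ℚ)
import Data.Rational.Properties as ℚP
import Data.Rational.Solver as ℚSolver
open import Data.Rational.Unnormalised as ℚᵘ using (mkℚᵘ; *≤*; *≡*)
import Data.Rational.Unnormalised.Properties as ℚᵘP
open import Data.Bool using (Bool; true; false; if_then_else_)
import Data.Bool.Properties as BoolP
open import Data.Fin as Fin using (Fin; toℕ)
open import Data.Fin.Patterns using (0F; 1F; 2F; 3F)
import Data.Fin.Properties as FinP
open import Data.Maybe using (Maybe; just; nothing; is-just)
import Data.Maybe.Properties as MaybeP
open import Data.Product using (∃-syntax; _×_; _,_; proj₁; proj₂)
open import Data.Sum using (_⊎_; inj₁; inj₂)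
open import Data.Empty using (⊥-elim)
open import Data.List using (List; []; _∷_; _++_; _ʳ++_; length; filter; map; foldr; reverse; take; concatMap
                           ; cartesianProduct; allFin; upTo; downFrom; applyUpTo)
import Data.List.Properties as ListP
open import Data.List.Membership.Propositional using (_∉_; find; lose)
open import Data.List.Membership.Propositional.Properties
  using (∈-++⁻; ∈-++⁺ˡ; ∈-++⁺ʳ; ∈-∃++; ∈-filter⁺; ∈-filter⁻; ∈-cartesianProduct⁺; ∈-allFin; ∈-concatMap⁺
        ; ∈-concatMap⁻; ∈-map⁺; ∈-map⁻; ∈-upTo⁺; ∈-downFrom⁺; ∈-downFrom⁻; ∈-applyUpTo⁺)
import Data.List.Membership.DecPropositional as DecMembership
open import Data.List.Relation.Binary.Permutation.Propositional using (↭⇒↭ₛ; ↭-sym)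
open import Data.List.Relation.Binary.Permutation.Propositional.Properties using (↭-reverse)
open import Data.List.Relation.Binary.Permutation.Setoid.Properties using (Unique-resp-↭)
open import Data.List.Relation.Unary.All as All using (All; []; _∷_)
open import Data.List.Relation.Unary.AllPairs using ([]; _∷_)
open import Data.List.Relation.Unary.Any as Any using (here; there)
open import Data.List.Relation.Unary.Any.Properties using (reverse⁺)
open import Data.List.Relation.Unary.Linked using (Linked; []; [-]; _∷_)
open import Data.List.Relation.Unary.Unique.DecPropositional using (unique?)
open import Data.List.Relation.Unary.Unique.Propositional using (Unique)
open import Data.List.Relation.Unary.Unique.Propositional.Properties
  using (Unique[x∷xs]⇒x∉xs; allFin⁺; map⁺; take⁺; cartesianProduct⁺) renaming (filter⁺ to unique-filter⁺)
open import Function using (_∘_)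
open import Relation.Binary.Definitions using (DecidableEquality; tri<; tri≈; tri>)
open import Relation.Binary.PropositionalEquality
open import Relation.Nullary using (¬_; Dec; yes; no; ¬?)
open import Relation.Nullary.Decidable using (_×-dec_; ⌊_⌋)

-- Client.  A structure is a path on l vertices with a further edge at each end leading back
-- into the path: l + 1 edges, and at most n^l l² choices.  If Client picks an offered edge
-- uniformly at random, he completes a structure of k edges with probability at most
-- (q + 1)^(−k), so the expected number of completed structures is at most
-- Σ_l l² n^l (q + 1)^(−l−1) < 1 as soon as (q − n)³ ≥ 8 n²; picking an edge that does not
-- increase the conditional expectation derandomises this.  A graph with a K₄-minor contains
-- such a structure: the branch sets induce more edges than vertices, deleting vertices of
-- degree at most 1 leaves minimum degree 2 and some vertex of degree 3, and a path through
-- that vertex, extended as far as possible at both ends, cannot close up to a mere cycle.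
--
-- Waiter.  Let m = n − q.  Waiter grows a path v₀ v₁ … by offering, at v_i, edges to new
-- vertices outside the residue class of i modulo r ≈ 2n/m.  Then v_i v_j stays free whenever
-- i < j and v_j ≡ i (mod r), so two segments of p r consecutive path vertices span at least
-- p² r ≥ q + 1 free edges, which Waiter offers in one round to link the two segments.  With
-- p ≈ √(m/2) there is room for t segments.

-- Client has to target structures with more edges than vertices: for l edges on l vertices the
-- terms n^l (q + 1)^(-l) stay close to 1 for all l much smaller than n/d, where d = q + 1 - n, and
-- their sum is not below 1 when d is small against n. One surplus edge gains a factor 1/(q + 1),
-- while the choice of the two inner ends costs l²; the sum is then at most 2(q + 1)²/d³, which
-- explains the exponent 2/3. The factor log n enters as log n ≥ 2, valid for n ≥ 8 because e² ≤ 8,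
-- and 2³ is the 8 in the condition on q.
--
-- Waiter's obstacle is that the round at v_i uses up q + 1 of the n - 1 edges there, while free
-- edges between every two segments are needed later. Which vertices join the path later is Client's
-- choice, so nothing can be reserved for particular vertices. Withholding a class that rotates with
-- i helps whatever Client picks: each new vertex lies in the class withheld at one path position
-- out of r. The slack m is shared about equally by the visited vertices and the withheld class.

∑ : ∀ {A : Set} → List A → (A → ℕ) → ℕ
∑ xs f = foldr (λ x → f x +_) 0 xs

∑-mono : ∀ {A : Set} {f g : A → ℕ} xs → (∀ x → x ∈ xs → f x ℕ.≤ g x) → ∑ xs f ℕ.≤ ∑ xs g
∑-mono []       f≤g = z≤n
∑-mono (x ∷ xs) f≤g = ℕP.+-mono-≤ (f≤g x (here refl)) (∑-mono xs λ y → f≤g y ∘ there)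

∑-cong : ∀ {A : Set} {f g : A → ℕ} xs → (∀ x → x ∈ xs → f x ≡ g x) → ∑ xs f ≡ ∑ xs g
∑-cong []       f≡g = refl
∑-cong (x ∷ xs) f≡g = cong₂ _+_ (f≡g x (here refl)) (∑-cong xs λ y → f≡g y ∘ there)

∑-++ : ∀ {A : Set} (f : A → ℕ) xs ys → ∑ (xs ++ ys) f ≡ ∑ xs f + ∑ ys f
∑-++ f []       ys = refl
∑-++ f (x ∷ xs) ys = trans (cong (f x +_) (∑-++ f xs ys)) (sym (ℕP.+-assoc (f x) _ _))

∑-map : ∀ {A B : Set} (f : B → ℕ) (g : A → B) xs → ∑ (map g xs) f ≡ ∑ xs (f ∘ g)
∑-map f g []       = refl
∑-map f g (x ∷ xs) = cong (f (g x) +_) (∑-map f g xs)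

∑-const : ∀ {A : Set} (c : ℕ) (xs : List A) → ∑ xs (λ _ → c) ≡ length xs * c
∑-const c []       = refl
∑-const c (x ∷ xs) = cong (c +_) (∑-const c xs)

∑-zero : ∀ {A : Set} (xs : List A) → ∑ xs (λ _ → 0) ≡ 0
∑-zero []       = refl
∑-zero (x ∷ xs) = ∑-zero xs

∑-*ˡ : ∀ {A : Set} (c : ℕ) (f : A → ℕ) xs → ∑ xs (λ x → c * f x) ≡ c * ∑ xs f
∑-*ˡ c f []       = sym (ℕP.*-zeroʳ c)
∑-*ˡ c f (x ∷ xs) = trans (cong (c * f x +_) (∑-*ˡ c f xs)) (sym (ℕP.*-distribˡ-+ c (f x) _))

∑-*ʳ : ∀ {A : Set} (c : ℕ) (f : A → ℕ) xs → ∑ xs (λ x → f x * c) ≡ ∑ xs f * c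
∑-*ʳ c f []       = refl
∑-*ʳ c f (x ∷ xs) = trans (cong (f x * c +_) (∑-*ʳ c f xs)) (sym (ℕP.*-distribʳ-+ c (f x) _))

∑-+ : ∀ {A : Set} (f g : A → ℕ) xs → ∑ xs (λ x → f x + g x) ≡ ∑ xs f + ∑ xs g
∑-+ f g []       = refl
∑-+ f g (x ∷ xs) = trans (cong (f x + g x +_) (∑-+ f g xs)) (interchange (f x) (g x) (∑ xs f) (∑ xs g))
  where
  interchange : ∀ a b c d → (a + b) + (c + d) ≡ (a + c) + (b + d)
  interchange = solve-∀

∑-swap : ∀ {A B : Set} (f : A → B → ℕ) xs ys →
         ∑ xs (λ x → ∑ ys (f x)) ≡ ∑ ys (λ y → ∑ xs (λ x → f x y))
∑-swap f []       ys = sym (∑-zero ys)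
∑-swap f (x ∷ xs) ys = trans (cong (∑ ys (f x) +_) (∑-swap f xs ys)) (sym (∑-+ (f x) _ ys))

term≤∑ : ∀ {A : Set} (f : A → ℕ) {x} xs → x ∈ xs → f x ℕ.≤ ∑ xs f
term≤∑ f (x ∷ xs) (here refl) = ℕP.m≤m+n (f x) _
term≤∑ f (y ∷ xs) (there x∈)  = ℕP.≤-trans (term≤∑ f xs x∈) (ℕP.m≤n+m _ (f y))

∑-single : ∀ {A : Set} (_≟_ : DecidableEquality A) {f : A → ℕ} {a} xs → Unique xs →
           (∀ x → x ∈ xs → x ≢ a → f x ≡ 0) → ∑ xs f ℕ.≤ f a
∑-single _≟_ []       _        _  = z≤n
∑-single _≟_ {f} {a} (x ∷ xs) (x∉ ∷ u) f0 with x ≟ a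
... | yes refl = ℕP.≤-reflexive (trans (cong (f x +_) tail≡0) (ℕP.+-identityʳ _))
  where
  tail≡0 : ∑ xs f ≡ 0
  tail≡0 = trans (∑-cong xs λ y y∈ → f0 y (there y∈) (≢-sym (All.lookup x∉ y∈))) (∑-zero xs)
... | no x≢a rewrite f0 x (here refl) x≢a = ∑-single _≟_ xs u λ y → f0 y ∘ there

-- Averaging: were every term at least `B`, the sum would be too large. This is what replaces
-- Client's random choice by a definite one.
∑-< : ∀ {A : Set} (f : A → ℕ) B xs → ∑ xs f ℕ.< length xs * B → ∃[ x ] (x ∈ xs × f x ℕ.< B)
∑-< f B (x ∷ xs) lt with f x ℕ.<? B
... | yes fx<B = x , here refl , fx<B
... | no  fx≮B = let y , y∈ , fy<B = ∑-< f B xs (ℕP.+-cancelˡ-< B _ _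
                       (ℕP.≤-<-trans (ℕP.+-monoˡ-≤ _ (ℕP.≮⇒≥ fx≮B)) lt))
                 in y , there y∈ , fy<B

∉⇒All≢ : ∀ {A : Set} {x : A} xs → x ∉ xs → All (x ≢_) xs
∉⇒All≢ xs x∉ = All.tabulate λ { y∈ refl → x∉ y∈ }

unique-⊆⇒length≤ : ∀ {A : Set} {xs ys : List A} → Unique xs → (∀ x → x ∈ xs → x ∈ ys) →
                   length xs ℕ.≤ length ys
unique-⊆⇒length≤ {xs = []}     _  _ = z≤n
unique-⊆⇒length≤ {xs = x ∷ xs} (x∉ ∷ u) sub with ∈-∃++ (sub x (here refl))
... | as , bs , refl = begin
  suc (length xs)         ≤⟨ s≤s (unique-⊆⇒length≤ u sub′) ⟩
  suc (length (as ++ bs)) ≡⟨ cong suc (ListP.length-++ as) ⟩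
  suc (length as + length bs) ≡⟨ ℕP.+-suc (length as) _ ⟨
  length as + suc (length bs) ≡⟨ ListP.length-++ as ⟨
  length (as ++ x ∷ bs)   ∎
  where
  open ℕP.≤-Reasoning
  sub′ : ∀ y → y ∈ xs → y ∈ as ++ bs
  sub′ y y∈ with ∈-++⁻ as (sub y (there y∈))
  ... | inj₁ y∈as         = ∈-++⁺ˡ y∈as
  ... | inj₂ (here refl)  = ⊥-elim (All.lookup x∉ y∈ refl)
  ... | inj₂ (there y∈bs) = ∈-++⁺ʳ as y∈bs

-- Edges of the complete graph as unordered pairs

module _ {n : ℕ} where

  mkEdge : Fin n → Fin n → Edge n
  mkEdge u v with u Fin.<? v
  ... | yes _ = u , v
  ... | no  _ = v , u

  mkEdge-cases : ∀ u v → (mkEdge u v ≡ (u , v)) ⊎ (mkEdge u v ≡ (v , u))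
  mkEdge-cases u v with u Fin.<? v
  ... | yes _ = inj₁ refl
  ... | no  _ = inj₂ refl

  mkEdge-comm : ∀ u v → mkEdge u v ≡ mkEdge v u
  mkEdge-comm u v with u Fin.<? v | v Fin.<? u
  ... | yes u<v | yes v<u = ⊥-elim (ℕP.<-asym u<v v<u)
  ... | yes _   | no  _   = refl
  ... | no  _   | yes _   = refl
  ... | no  u≮v | no  v≮u with FinP.<-cmp u v
  ... | tri< u<v _ _ = ⊥-elim (u≮v u<v)
  ... | tri≈ _ refl _ = refl
  ... | tri> _ _ v<u = ⊥-elim (v≮u v<u)

  mkEdge-ordered : ∀ {u v} → u Fin.< v → mkEdge u v ≡ (u , v)
  mkEdge-ordered {u} {v} u<v with u Fin.<? v
  ... | yes _   = refl
  ... | no  u≮v = ⊥-elim (u≮v u<v)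

  mkEdge-injective : ∀ {a b c d} → mkEdge a b ≡ mkEdge c d → (a ≡ c × b ≡ d) ⊎ (a ≡ d × b ≡ c)
  mkEdge-injective {a} {b} {c} {d} eq with mkEdge-cases a b | mkEdge-cases c d
  ... | inj₁ p | inj₁ q with trans (sym p) (trans eq q)
  ... | refl = inj₁ (refl , refl)
  mkEdge-injective {a} {b} {c} {d} eq | inj₁ p | inj₂ q with trans (sym p) (trans eq q)
  ... | refl = inj₂ (refl , refl)
  mkEdge-injective {a} {b} {c} {d} eq | inj₂ p | inj₁ q with trans (sym p) (trans eq q)
  ... | refl = inj₂ (refl , refl)
  mkEdge-injective {a} {b} {c} {d} eq | inj₂ p | inj₂ q with trans (sym p) (trans eq q)
  ... | refl = inj₁ (refl , refl)

  ordered∈allEdges : ∀ {u v : Fin n} → u Fin.< v → (u , v) ∈ allEdges n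
  ordered∈allEdges u<v =
    ∈-filter⁺ _ (∈-cartesianProduct⁺ (∈-allFin _) (∈-allFin _)) u<v

  allEdges-ordered : ∀ {u v : Fin n} → (u , v) ∈ allEdges n → u Fin.< v
  allEdges-ordered = proj₂ ∘ ∈-filter⁻ (λ e → proj₁ e Fin.<? proj₂ e) {xs = cartesianProduct (allFin n) (allFin n)}

  mkEdge∈allEdges : ∀ {u v} → u ≢ v → mkEdge u v ∈ allEdges n
  mkEdge∈allEdges {u} {v} u≢v with FinP.<-cmp u v
  ... | tri< u<v _ _ rewrite mkEdge-ordered u<v = ordered∈allEdges u<v
  ... | tri≈ _ u≡v _ = ⊥-elim (u≢v u≡v)
  ... | tri> _ _ v<u rewrite mkEdge-comm u v | mkEdge-ordered v<u = ordered∈allEdges v<u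

  mkEdge∈⇒Adj : ∀ {C u v} → mkEdge u v ∈ C → Adj C u v
  mkEdge∈⇒Adj {C} {u} {v} e∈ with mkEdge-cases u v
  ... | inj₁ p = inj₁ (subst (_∈ C) p e∈)
  ... | inj₂ p = inj₂ (subst (_∈ C) p e∈)

  -- `Adj` also accepts a pair stored in the wrong order; containment in `allEdges n` rules such
  -- pairs out.
  Adj⇒mkEdge∈ : ∀ {C u v} → (∀ e → e ∈ C → e ∈ allEdges n) → Adj C u v → mkEdge u v ∈ C
  Adj⇒mkEdge∈ {C} C⊆ (inj₁ uv∈) = subst (_∈ C) (sym (mkEdge-ordered (allEdges-ordered (C⊆ _ uv∈)))) uv∈
  Adj⇒mkEdge∈ {C} {u} {v} C⊆ (inj₂ vu∈) =
    subst (_∈ C) (sym (trans (mkEdge-comm u v) (mkEdge-ordered (allEdges-ordered (C⊆ _ vu∈))))) vu∈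

  Adj-sym : ∀ {C : List (Edge n)} {u v} → Adj C u v → Adj C v u
  Adj-sym (inj₁ p) = inj₂ p
  Adj-sym (inj₂ p) = inj₁ p

  ∈-∖⁺ : ∀ {F S : List (Edge n)} {e} → e ∈ F → e ∉ S → e ∈ F ∖ S
  ∈-∖⁺ = ∈-filter⁺ _

  ∈-∖⁻ : ∀ {F S : List (Edge n)} {e} → e ∈ F ∖ S → e ∈ F × e ∉ S
  ∈-∖⁻ {S = S} = ∈-filter⁻ (λ e → ¬? (DecMembership._∈?_ _≟E_ e S))

  length-∖-< : ∀ {F S : List (Edge n)} {e} → e ∈ F → e ∈ S → length (F ∖ S) ℕ.< length F
  length-∖-< e∈F e∈S = ListP.filter-notAll _ _ (Any.map (λ { refl e∉S → e∉S e∈S }) e∈F)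

-- Client avoids a light family of edge sets

ClientWins-map : ∀ {n q} {P Q : List (Edge n) → Set} → (∀ C → P C → Q C) →
                 ∀ {F C} → ClientWins q P F C → ClientWins q Q F C
ClientWins-map f (endC F≤ p)       = endC F≤ (f _ p)
ClientWins-map f (roundC F≥ p win) = roundC F≥ (f _ p) λ S offer →
  let e , e∈S , w = win S offer in e , e∈S , ClientWins-map f w

module Potential {n : ℕ} (q : ℕ) where

  open DecMembership (_≟E_ {n}) using (_∈?_)

  -- q + 1 times the upper bound 1, 1/(q + 1) or 0 for the conditional probability that a random
  -- Client gets the edge; the rescaling keeps all quantities natural numbers.
  charge : List (Edge n) → List (Edge n) → Edge n → ℕ
  charge F C e with e ∈? C | e ∈? F
  ... | yes _ | _     = suc q
  ... | no  _ | yes _ = 1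
  ... | no  _ | no  _ = 0

  charge-claimed : ∀ {F C e} → e ∈ C → charge F C e ≡ suc q
  charge-claimed {F} {C} {e} e∈C with e ∈? C | e ∈? F
  ... | yes _   | _ = refl
  ... | no  e∉C | _ = ⊥-elim (e∉C e∈C)

  charge-free : ∀ {F C e} → e ∉ C → e ∈ F → charge F C e ≡ 1
  charge-free {F} {C} {e} e∉C e∈F with e ∈? C | e ∈? F
  ... | yes e∈C | _       = ⊥-elim (e∉C e∈C)
  ... | no  _   | yes _   = refl
  ... | no  _   | no  e∉F = ⊥-elim (e∉F e∈F)

  charge-lost : ∀ {F C e} → e ∉ C → e ∉ F → charge F C e ≡ 0
  charge-lost {F} {C} {e} e∉C e∉F with e ∈? C | e ∈? F
  ... | yes e∈C | _       = ⊥-elim (e∉C e∈C)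
  ... | no  _   | yes e∈F = ⊥-elim (e∉F e∈F)
  ... | no  _   | no  _   = refl

  ∉-∷ : ∀ {C} {e g : Edge n} → e ≢ g → g ∉ C → g ∉ e ∷ C
  ∉-∷ e≢g g∉C (here g≡e)  = e≢g (sym g≡e)
  ∉-∷ e≢g g∉C (there g∈C) = g∉C g∈C

  charge-unoffered : ∀ {F C S e g} → e ≢ g → g ∉ S → charge (F ∖ S) (e ∷ C) g ≡ charge F C g
  charge-unoffered {F} {C} {S} {e} {g} e≢g g∉S = go (g ∈? C) (g ∈? F)
    where
    go : Dec (g ∈ C) → Dec (g ∈ F) → charge (F ∖ S) (e ∷ C) g ≡ charge F C g
    go (yes g∈C) _ = trans (charge-claimed {F ∖ S} {e ∷ C} (there g∈C)) (sym (charge-claimed {F} g∈C))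
    go (no g∉C) (yes g∈F) =
      trans (charge-free {F ∖ S} {e ∷ C} (∉-∷ e≢g g∉C) (∈-∖⁺ g∈F g∉S)) (sym (charge-free g∉C g∈F))
    go (no g∉C) (no g∉F) =
      trans (charge-lost {F ∖ S} {e ∷ C} (∉-∷ e≢g g∉C) (g∉F ∘ proj₁ ∘ ∈-∖⁻)) (sym (charge-lost g∉C g∉F))

  charge-≤ : ∀ {F C S e g} → e ≢ g → charge (F ∖ S) (e ∷ C) g ℕ.≤ charge F C g
  charge-≤ {F} {C} {S} {e} {g} e≢g = go (g ∈? S) (g ∈? C)
    where
    go : Dec (g ∈ S) → Dec (g ∈ C) → charge (F ∖ S) (e ∷ C) g ℕ.≤ charge F C g
    go (no g∉S) _ = ℕP.≤-reflexive (charge-unoffered {F} {C} e≢g g∉S)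
    go (yes g∈S) (yes g∈C) = ℕP.≤-reflexive
      (trans (charge-claimed {F ∖ S} {e ∷ C} (there g∈C)) (sym (charge-claimed {F} g∈C)))
    go (yes g∈S) (no g∉C) = subst (ℕ._≤ charge F C g)
      (sym (charge-lost {F ∖ S} {e ∷ C} (∉-∷ e≢g g∉C) (λ g∈ → proj₂ (∈-∖⁻ {F = F} g∈) g∈S))) z≤n

  weight : List (Edge n) → List (Edge n) → List (Edge n) → ℕ
  weight F C []      = 1
  weight F C (e ∷ σ) = charge F C e * weight F C σ

  weight-claimed : ∀ {F C} σ → (∀ e → e ∈ σ → e ∈ C) → weight F C σ ≡ suc q ^ length σ
  weight-claimed         []      _  = refl
  weight-claimed {F} {C} (e ∷ σ) σ⊆ =
    cong₂ _*_ (charge-claimed {F} {C} (σ⊆ e (here refl))) (weight-claimed σ λ g → σ⊆ g ∘ there)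

  weight-[]-≤1 : ∀ {F} σ → weight F [] σ ℕ.≤ 1
  weight-[]-≤1         []      = ℕP.≤-refl
  weight-[]-≤1 {F} (e ∷ σ) = ℕP.*-mono-≤ charge≤1 (weight-[]-≤1 σ)
    where
    charge≤1 : charge F [] e ℕ.≤ 1
    charge≤1 with e ∈? F
    ... | yes _ = ℕP.≤-refl
    ... | no  _ = z≤n

  weight-≤ : ∀ {F C S e} σ → e ∉ σ → weight (F ∖ S) (e ∷ C) σ ℕ.≤ weight F C σ
  weight-≤             []      _  = ℕP.≤-refl
  weight-≤ {F} {C} (g ∷ σ) e∉ =
    ℕP.*-mono-≤ (charge-≤ {F} {C} (e∉ ∘ here)) (weight-≤ σ (e∉ ∘ there))

  -- A uniformly random choice from the offer is fair: a single offered edge of σ is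
  -- claimed with probability 1/(q+1), and two offered edges of σ kill σ.
  weight-average : ∀ {F C S} σ → Unique σ → (∀ e → e ∈ F → e ∉ C) → Offer q F S →
                   ∑ S (λ e → weight (F ∖ S) (e ∷ C) σ) ℕ.≤ suc q * weight F C σ
  weight-average {S = S} [] _ _ (|S| , _) =
    ℕP.≤-reflexive (trans (∑-const 1 S) (cong (_* 1) |S|))
  weight-average {F} {C} {S} (g ∷ σ) (g∉ ∷ u) disj offer@(_ , uS , S⊆F) with g ∈? S
  ... | no g∉S = begin
    ∑ S (λ e → charge (F ∖ S) (e ∷ C) g * weight (F ∖ S) (e ∷ C) σ)
      ≡⟨ ∑-cong S (λ e e∈S → cong (_* weight (F ∖ S) (e ∷ C) σ) (charge-unoffered {F} {C} (λ e≡g → g∉S (subst (_∈ S) e≡g e∈S)) g∉S)) ⟩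
    ∑ S (λ e → charge F C g * weight (F ∖ S) (e ∷ C) σ)
      ≡⟨ ∑-*ˡ (charge F C g) _ S ⟩
    charge F C g * ∑ S (λ e → weight (F ∖ S) (e ∷ C) σ)
      ≤⟨ ℕP.*-monoʳ-≤ (charge F C g) (weight-average σ u disj offer) ⟩
    charge F C g * (suc q * weight F C σ)
      ≡⟨ exchange (charge F C g) (suc q) _ ⟩
    suc q * (charge F C g * weight F C σ) ∎
    where
    open ℕP.≤-Reasoning
    exchange : ∀ a b c → a * (b * c) ≡ b * (a * c)
    exchange = solve-∀
  ... | yes g∈S = begin
    ∑ S (λ e → charge (F ∖ S) (e ∷ C) g * weight (F ∖ S) (e ∷ C) σ)
      ≤⟨ ∑-single _≟E_ {a = g} S uS killed ⟩
    charge (F ∖ S) (g ∷ C) g * weight (F ∖ S) (g ∷ C) σ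
      ≤⟨ ℕP.*-mono-≤ (ℕP.≤-reflexive (charge-claimed {F ∖ S} {g ∷ C} (here refl)))
                     (weight-≤ σ (λ g∈σ → All.lookup g∉ g∈σ refl)) ⟩
    suc q * weight F C σ
      ≡⟨ cong (suc q *_) (ℕP.*-identityˡ _) ⟨
    suc q * (1 * weight F C σ)
      ≡⟨ cong (λ c → suc q * (c * weight F C σ)) (charge-free {F} {C} (disj g (S⊆F g g∈S)) (S⊆F g g∈S)) ⟨
    suc q * (charge F C g * weight F C σ) ∎
    where
    open ℕP.≤-Reasoning
    killed : ∀ e → e ∈ S → e ≢ g → charge (F ∖ S) (e ∷ C) g * weight (F ∖ S) (e ∷ C) σ ≡ 0
    killed e _ e≢g = cong (_* weight (F ∖ S) (e ∷ C) σ)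
      (charge-lost {F ∖ S} {e ∷ C} (∉-∷ e≢g (disj g (S⊆F g g∈S))) (λ g∈ → proj₂ (∈-∖⁻ {F = F} g∈) g∈S))

  module _ (M : ℕ) (family : List (List (Edge n)))
           (unique : ∀ σ → σ ∈ family → Unique σ)
           (bounded : ∀ σ → σ ∈ family → length σ ℕ.≤ M) where

    -- The second factor brings sets of different sizes to the common denominator (q + 1)^M: the
    -- potential is (q + 1)^M times the bound on the expected number of members claimed in full.
    potential : List (Edge n) → List (Edge n) → ℕ
    potential F C = ∑ family λ σ → weight F C σ * suc q ^ (M ∸ length σ)

    Avoids : List (Edge n) → Set
    Avoids C = ∀ σ → σ ∈ family → ¬ (∀ e → e ∈ σ → e ∈ C)

    -- A single member claimed in full already contributes (q + 1)^M.
    small⇒avoids : ∀ {F C} → potential F C ℕ.< suc q ^ M → Avoids C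
    small⇒avoids {F} {C} Φ< σ σ∈ σ⊆C = ℕP.<⇒≱ Φ< (begin
      suc q ^ M                                  ≡⟨ cong (suc q ^_) (ℕP.m+[n∸m]≡n (bounded σ σ∈)) ⟨
      suc q ^ (length σ + (M ∸ length σ))        ≡⟨ ℕP.^-distribˡ-+-* (suc q) (length σ) _ ⟩
      suc q ^ length σ * suc q ^ (M ∸ length σ)  ≡⟨ cong (_* _) (weight-claimed {F} σ σ⊆C) ⟨
      weight F C σ * suc q ^ (M ∸ length σ)      ≤⟨ term≤∑ _ family σ∈ ⟩
      potential F C                              ∎)
      where open ℕP.≤-Reasoning

    potential-average : ∀ {F C S} → (∀ e → e ∈ F → e ∉ C) → Offer q F S →
                        ∑ S (λ e → potential (F ∖ S) (e ∷ C)) ℕ.≤ suc q * potential F C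
    potential-average {F} {C} {S} disj offer = begin
      ∑ S (λ e → potential (F ∖ S) (e ∷ C))
        ≡⟨ ∑-swap (λ e σ → weight (F ∖ S) (e ∷ C) σ * scale σ) S family ⟩
      ∑ family (λ σ → ∑ S (λ e → weight (F ∖ S) (e ∷ C) σ * scale σ))
        ≡⟨ ∑-cong family (λ σ _ → ∑-*ʳ (scale σ) (λ e → weight (F ∖ S) (e ∷ C) σ) S) ⟩
      ∑ family (λ σ → ∑ S (λ e → weight (F ∖ S) (e ∷ C) σ) * scale σ)
        ≤⟨ ∑-mono family (λ σ σ∈ → ℕP.*-monoˡ-≤ (scale σ) (weight-average σ (unique σ σ∈) disj offer)) ⟩
      ∑ family (λ σ → suc q * weight F C σ * scale σ)
        ≡⟨ ∑-cong family (λ σ _ → ℕP.*-assoc (suc q) (weight F C σ) (scale σ)) ⟩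
      ∑ family (λ σ → suc q * (weight F C σ * scale σ))
        ≡⟨ ∑-*ˡ (suc q) _ family ⟩
      suc q * potential F C ∎
      where
      open ℕP.≤-Reasoning
      scale : List (Edge n) → ℕ
      scale σ = suc q ^ (M ∸ length σ)

    -- Containment in `allEdges n` travels with the avoidance because reading adjacency in Client's
    -- graph off `mkEdge` depends on it.
    ClientSafe : List (Edge n) → Set
    ClientSafe C = (∀ e → e ∈ C → e ∈ allEdges n) × Avoids C

    defend : ∀ k {F C} → length F ℕ.≤ k → (∀ e → e ∈ F → e ∈ allEdges n) →
             (∀ e → e ∈ C → e ∈ allEdges n) → (∀ e → e ∈ F → e ∉ C) →
             potential F C ℕ.< suc q ^ M → ClientWins q ClientSafe F C
    defend zero {F} {C} F≤0 F⊆ C⊆ disj Φ< =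
      endC (ℕP.≤-trans F≤0 z≤n) (C⊆ , small⇒avoids {F} Φ<)
    defend (suc k) {F} {C} F≤k F⊆ C⊆ disj Φ< with length F ℕ.≤? q
    ... | yes F≤q = endC F≤q (C⊆ , small⇒avoids {F} Φ<)
    ... | no  F≰q = roundC (ℕP.≰⇒> F≰q) (C⊆ , small⇒avoids {F} Φ<) respond
      where
      respond : ∀ S → Offer q F S → ∃[ e ] (e ∈ S × ClientWins q ClientSafe (F ∖ S) (e ∷ C))
      respond S offer@(|S| , uS , S⊆F) = e , e∈S , defend k
          (ℕP.≤-pred (ℕP.≤-trans (length-∖-< (S⊆F e e∈S) e∈S) F≤k))
          (λ g → F⊆ g ∘ proj₁ ∘ ∈-∖⁻) (λ { g (here refl) → F⊆ g (S⊆F g e∈S) ; g (there g∈C) → C⊆ g g∈C })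
          (λ { g g∈ (here refl) → proj₂ (∈-∖⁻ {F = F} g∈) e∈S ; g g∈ (there g∈C) → disj g (proj₁ (∈-∖⁻ g∈)) g∈C })
          Φe<
        where
        -- An offer has exactly q + 1 edges, so the average over the possible answers does not
        -- exceed the current potential.
        average< : ∑ S (λ e → potential (F ∖ S) (e ∷ C)) ℕ.< length S * suc q ^ M
        average< = ℕP.≤-<-trans (potential-average disj offer)
          (subst (λ s → suc q * potential F C ℕ.< s * suc q ^ M) (sym |S|) (ℕP.*-monoʳ-< (suc q) Φ<))
        choice : ∃[ e ] (e ∈ S × potential (F ∖ S) (e ∷ C) ℕ.< suc q ^ M)
        choice = ∑-< _ _ S average<
        e = proj₁ choice
        e∈S = proj₁ (proj₂ choice)
        Φe< = proj₂ (proj₂ choice)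

    client-avoids : ∑ family (λ σ → suc q ^ (M ∸ length σ)) ℕ.< suc q ^ M →
                    ClientWins q ClientSafe (allEdges n) []
    client-avoids small = defend _ ℕP.≤-refl (λ _ e∈ → e∈) (λ _ ()) (λ _ _ ())
      (ℕP.≤-<-trans (∑-mono family λ σ _ →
        ℕP.≤-trans (ℕP.*-monoˡ-≤ _ (weight-[]-≤1 σ)) (ℕP.≤-reflexive (ℕP.*-identityˡ _))) small)

-- Dense subgraphs of K₄-minor hosts

χ : Bool → ℕ
χ b = if b then 1 else 0

module DegreeSums {n : ℕ} (E : Fin n → Fin n → Bool)
                  (E-sym : ∀ u v → E u v ≡ E v u) (E-irrefl : ∀ u → E u u ≡ false) where

  V : List (Fin n)
  V = allFin n

  a : Fin n → Fin n → ℕ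
  a u v = χ (E u v)

  δ : Fin n → Fin n → ℕ
  δ w v = χ ⌊ v FinP.≟ w ⌋

  size : (Fin n → ℕ) → ℕ
  size x = ∑ V x

  deg : (Fin n → ℕ) → Fin n → ℕ
  deg x u = ∑ V λ v → x v * a u v

  -- On indicator functions this counts adjacent ordered pairs, so ⟨ x , x ⟩ is twice the number of
  -- edges inside x. With ℕ-valued functions instead of sets, disjoint unions become sums and the
  -- form is bilinear.
  ⟨_,_⟩ : (Fin n → ℕ) → (Fin n → ℕ) → ℕ
  ⟨ x , y ⟩ = ∑ V λ u → x u * deg y u

  _⊕_ : (Fin n → ℕ) → (Fin n → ℕ) → Fin n → ℕ
  (x ⊕ y) v = x v + y v

  δ-refl : ∀ w → δ w w ≡ 1
  δ-refl w with w FinP.≟ w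
  ... | yes _   = refl
  ... | no  w≢w = ⊥-elim (w≢w refl)

  δ-≢ : ∀ {v w} → v ≢ w → δ w v ≡ 0
  δ-≢ {v} {w} v≢w with v FinP.≟ w
  ... | yes v≡w = ⊥-elim (v≢w v≡w)
  ... | no  _   = refl

  ∑-δ : ∀ w (f : Fin n → ℕ) → ∑ V (λ v → δ w v * f v) ≡ f w
  ∑-δ w f = ℕP.≤-antisym
    (subst (∑ V (λ v → δ w v * f v) ℕ.≤_) at-w
      (∑-single FinP._≟_ V (allFin⁺ n) λ v _ v≢w → cong (_* f v) (δ-≢ v≢w)))
    (subst (ℕ._≤ ∑ V (λ v → δ w v * f v)) at-w (term≤∑ (λ v → δ w v * f v) V (∈-allFin w)))
    where
    at-w : δ w w * f w ≡ f w
    at-w = trans (cong (_* f w) (δ-refl w)) (ℕP.*-identityˡ (f w))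

  size-δ : ∀ w → size (δ w) ≡ 1
  size-δ w = trans (∑-cong V λ v _ → sym (ℕP.*-identityʳ (δ w v))) (∑-δ w λ _ → 1)

  deg-δ : ∀ w u → deg (δ w) u ≡ a u w
  deg-δ w u = ∑-δ w (a u)

  deg-⊕ : ∀ x y u → deg (x ⊕ y) u ≡ deg x u + deg y u
  deg-⊕ x y u = trans (∑-cong V λ v _ → ℕP.*-distribʳ-+ (a u v) (x v) (y v)) (∑-+ _ _ V)

  deg-cong : ∀ {x y} → (∀ v → x v ≡ y v) → ∀ u → deg x u ≡ deg y u
  deg-cong x≡y u = ∑-cong V λ v _ → cong (_* a u v) (x≡y v)

  ⟨⟩-cong : ∀ {x x′ y y′} → (∀ v → x v ≡ x′ v) → (∀ v → y v ≡ y′ v) → ⟨ x , y ⟩ ≡ ⟨ x′ , y′ ⟩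
  ⟨⟩-cong x≡ y≡ = ∑-cong V λ u _ → cong₂ _*_ (x≡ u) (deg-cong y≡ u)

  ⟨⟩-⊕ˡ : ∀ x y z → ⟨ x ⊕ y , z ⟩ ≡ ⟨ x , z ⟩ + ⟨ y , z ⟩
  ⟨⟩-⊕ˡ x y z = trans (∑-cong V λ u _ → ℕP.*-distribʳ-+ (deg z u) (x u) (y u)) (∑-+ _ _ V)

  ⟨⟩-comm : ∀ x y → ⟨ x , y ⟩ ≡ ⟨ y , x ⟩
  ⟨⟩-comm x y = begin
    ∑ V (λ u → x u * ∑ V (λ v → y v * a u v))   ≡⟨ ∑-cong V (λ u _ → ∑-*ˡ (x u) _ V) ⟨
    ∑ V (λ u → ∑ V (λ v → x u * (y v * a u v))) ≡⟨ ∑-swap _ V V ⟩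
    ∑ V (λ v → ∑ V (λ u → x u * (y v * a u v)))
      ≡⟨ ∑-cong V (λ v _ → ∑-cong V λ u _ →
           trans (exchange (x u) (y v) (a u v)) (cong (λ b → y v * (x u * χ b)) (E-sym u v))) ⟩
    ∑ V (λ v → ∑ V (λ u → y v * (x u * a v u))) ≡⟨ ∑-cong V (λ v _ → ∑-*ˡ (y v) _ V) ⟩
    ∑ V (λ v → y v * ∑ V (λ u → x u * a v u))   ∎
    where
    open ≡-Reasoning
    exchange : ∀ b c d → b * (c * d) ≡ c * (b * d)
    exchange = solve-∀

  ⟨⟩-⊕ʳ : ∀ x y z → ⟨ x , y ⊕ z ⟩ ≡ ⟨ x , y ⟩ + ⟨ x , z ⟩
  ⟨⟩-⊕ʳ x y z = trans (⟨⟩-comm x (y ⊕ z)) (trans (⟨⟩-⊕ˡ y z x) (cong₂ _+_ (⟨⟩-comm y x) (⟨⟩-comm z x)))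

  ⟨δ,⟩ : ∀ w x → ⟨ δ w , x ⟩ ≡ deg x w
  ⟨δ,⟩ w x = ∑-δ w (deg x)

  insert-deg : ∀ x w → ⟨ x ⊕ δ w , x ⊕ δ w ⟩ ≡ ⟨ x , x ⟩ + 2 * deg x w
  insert-deg x w = begin
    ⟨ x ⊕ δ w , x ⊕ δ w ⟩                       ≡⟨ ⟨⟩-⊕ˡ x (δ w) (x ⊕ δ w) ⟩
    ⟨ x , x ⊕ δ w ⟩ + ⟨ δ w , x ⊕ δ w ⟩         ≡⟨ cong₂ _+_ (⟨⟩-⊕ʳ x x (δ w)) (⟨⟩-⊕ʳ (δ w) x (δ w)) ⟩
    ⟨ x , x ⟩ + ⟨ x , δ w ⟩ + (⟨ δ w , x ⟩ + ⟨ δ w , δ w ⟩)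
      ≡⟨ cong₂ (λ p r → ⟨ x , x ⟩ + p + (⟨ δ w , x ⟩ + r)) (⟨⟩-comm x (δ w)) loop ⟩
    ⟨ x , x ⟩ + ⟨ δ w , x ⟩ + (⟨ δ w , x ⟩ + 0) ≡⟨ cong (λ d → ⟨ x , x ⟩ + d + (d + 0)) (⟨δ,⟩ w x) ⟩
    ⟨ x , x ⟩ + deg x w + (deg x w + 0)         ≡⟨ ℕP.+-assoc ⟨ x , x ⟩ _ _ ⟩
    ⟨ x , x ⟩ + 2 * deg x w                     ∎
    where
    open ≡-Reasoning
    loop : ⟨ δ w , δ w ⟩ ≡ 0
    loop = trans (⟨δ,⟩ w (δ w)) (trans (deg-δ w w) (cong χ (E-irrefl w)))

  insert : Fin n → (Fin n → Bool) → Fin n → Bool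
  insert w T v = if ⌊ v FinP.≟ w ⌋ then true else T v

  remove : Fin n → (Fin n → Bool) → Fin n → Bool
  remove w T v = if ⌊ v FinP.≟ w ⌋ then false else T v

  insert-χ : ∀ {w T} → T w ≡ false → ∀ v → χ (insert w T v) ≡ χ (T v) + δ w v
  insert-χ {w} Tw v with v FinP.≟ w
  ... | yes refl rewrite Tw = refl
  ... | no  _    = sym (ℕP.+-identityʳ _)

  remove-χ : ∀ {w T} → T w ≡ true → ∀ v → χ (T v) ≡ χ (remove w T v) + δ w v
  remove-χ {w} Tw v with v FinP.≟ w
  ... | yes refl rewrite Tw = refl
  ... | no  _    = sym (ℕP.+-identityʳ _)

  size-insert : ∀ {x y w} → (∀ v → y v ≡ x v + δ w v) → size y ≡ suc (size x)
  size-insert {x} {y} {w} y≡ = begin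
    size y                ≡⟨ ∑-cong V (λ v _ → y≡ v) ⟩
    ∑ V (x ⊕ δ w)         ≡⟨ ∑-+ x (δ w) V ⟩
    size x + size (δ w)   ≡⟨ cong (size x +_) (size-δ w) ⟩
    size x + 1            ≡⟨ ℕP.+-comm (size x) 1 ⟩
    suc (size x)          ∎
    where open ≡-Reasoning

  deg-mono-edge : ∀ {T : Fin n → Bool} {u w} → T u ≡ true → E w u ≡ true → 1 ℕ.≤ deg (χ ∘ T) w
  deg-mono-edge {T} {u} {w} Tu Ewu = subst (ℕ._≤ deg (χ ∘ T) w)
    (cong₂ (λ b c → χ b * χ c) Tu Ewu) (term≤∑ (λ v → χ (T v) * a w v) V (∈-allFin u))

  -- The crossing hypothesis is connectedness of B: a subset T of B grows by one vertex and at
  -- least one edge at a time.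
  connected-deg : (B : Fin n → Bool) →
    (∀ (T : Fin n → Bool) u w → T u ≡ true → T w ≡ false → B u ≡ true → B w ≡ true →
       ∃[ u′ ] ∃[ w′ ] (T u′ ≡ true × T w′ ≡ false × B w′ ≡ true × E w′ u′ ≡ true)) →
    ∀ v → B v ≡ true → 2 * size (χ ∘ B) ℕ.≤ ⟨ χ ∘ B , χ ∘ B ⟩ + 2
  connected-deg B cross r Br = grow (size (χ ∘ B)) start (start-⊆) start-r
      (ℕP.m≤n+m _ _) start-deg
    where
    start : Fin n → Bool
    start v = ⌊ v FinP.≟ r ⌋
    start-⊆ : ∀ v → start v ≡ true → B v ≡ true
    start-⊆ v eq with v FinP.≟ r
    ... | yes refl = Br
    start-r : start r ≡ true
    start-r with r FinP.≟ r
    ... | yes _   = refl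
    ... | no  r≢r = ⊥-elim (r≢r refl)
    start-deg : 2 * size (χ ∘ start) ℕ.≤ ⟨ χ ∘ start , χ ∘ start ⟩ + 2
    start-deg = ℕP.≤-trans (ℕP.≤-reflexive (cong (2 *_) (size-δ r))) (ℕP.m≤n+m 2 _)
    -- The fuel `k` bounds the number of vertices of `B` outside `T`; the last premise says that `T`
    -- spans at least |T| - 1 edges.
    grow : ∀ k (T : Fin n → Bool) → (∀ v → T v ≡ true → B v ≡ true) → T r ≡ true →
           size (χ ∘ B) ℕ.≤ size (χ ∘ T) + k →
           2 * size (χ ∘ T) ℕ.≤ ⟨ χ ∘ T , χ ∘ T ⟩ + 2 →
           2 * size (χ ∘ B) ℕ.≤ ⟨ χ ∘ B , χ ∘ B ⟩ + 2
    grow k T T⊆B Tr fuel Tdeg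
      with FinP.any? (λ w → (B w BoolP.≟ true) ×-dec (T w BoolP.≟ false))
    ... | no none = subst₂ (λ s d → 2 * s ℕ.≤ d + 2) (∑-cong V λ v _ → T≡B v) (⟨⟩-cong T≡B T≡B) Tdeg
      where
      T≡B : ∀ v → χ (T v) ≡ χ (B v)
      T≡B v with T v in Tv | B v in Bv
      ... | true  | true  = refl
      ... | false | false = refl
      ... | false | true  = ⊥-elim (none (v , Bv , Tv))
      ... | true  | false with trans (sym (T⊆B v Tv)) Bv
      ... | ()
    ... | yes (w , Bw , Tw) with cross T r w Tr Tw Br Bw
    ... | u′ , w′ , Tu′ , Tw′ , Bw′ , edge = next k fuel
      where
      T′ : Fin n → Bool
      T′ = insert w′ T
      χT′ : ∀ v → χ (T′ v) ≡ χ (T v) + δ w′ v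
      χT′ = insert-χ Tw′
      size′ : size (χ ∘ T′) ≡ suc (size (χ ∘ T))
      size′ = size-insert χT′
      T′⊆B : ∀ v → T′ v ≡ true → B v ≡ true
      T′⊆B v T′v with v FinP.≟ w′
      ... | yes refl = Bw′
      ... | no  _    = T⊆B v T′v
      T′r : T′ r ≡ true
      T′r with r FinP.≟ w′
      ... | yes _ = refl
      ... | no  _ = Tr
      χ-mono : ∀ v → χ (T′ v) ℕ.≤ χ (B v)
      χ-mono v with T′ v in T′v
      ... | false = z≤n
      ... | true rewrite T′⊆B v T′v = ℕP.≤-refl
      deg′ : 2 * size (χ ∘ T′) ℕ.≤ ⟨ χ ∘ T′ , χ ∘ T′ ⟩ + 2
      deg′ = begin
        2 * size (χ ∘ T′)                             ≡⟨ cong (2 *_) size′ ⟩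
        2 * suc (size (χ ∘ T))                        ≡⟨ ℕP.*-suc 2 _ ⟩
        2 + 2 * size (χ ∘ T)                          ≤⟨ ℕP.+-mono-≤ (ℕP.*-monoʳ-≤ 2 (deg-mono-edge {T} Tu′ edge)) Tdeg ⟩
        2 * deg (χ ∘ T) w′ + (⟨ χ ∘ T , χ ∘ T ⟩ + 2)  ≡⟨ rearrange (deg (χ ∘ T) w′) _ ⟩
        ⟨ χ ∘ T , χ ∘ T ⟩ + 2 * deg (χ ∘ T) w′ + 2    ≡⟨ cong (_+ 2) (insert-deg (χ ∘ T) w′) ⟨
        ⟨ (χ ∘ T) ⊕ δ w′ , (χ ∘ T) ⊕ δ w′ ⟩ + 2       ≡⟨ cong (_+ 2) (⟨⟩-cong χT′ χT′) ⟨
        ⟨ χ ∘ T′ , χ ∘ T′ ⟩ + 2                       ∎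
        where
        open ℕP.≤-Reasoning
        rearrange : ∀ d e → 2 * d + (e + 2) ≡ e + 2 * d + 2
        rearrange = solve-∀
      next : ∀ k → size (χ ∘ B) ℕ.≤ size (χ ∘ T) + k → 2 * size (χ ∘ B) ℕ.≤ ⟨ χ ∘ B , χ ∘ B ⟩ + 2
      next zero fuel = ⊥-elim (ℕP.<⇒≱ (ℕP.≤-trans (ℕP.≤-reflexive (sym size′)) (∑-mono V λ v _ → χ-mono v))
                                      (ℕP.≤-trans fuel (ℕP.≤-reflexive (ℕP.+-identityʳ _))))
      next (suc k) fuel = grow k T′ T′⊆B T′r
        (ℕP.≤-trans fuel (ℕP.≤-reflexive (trans (ℕP.+-suc _ k) (cong (_+ k) (sym size′))))) deg′

  MinDegree2 : (Fin n → Bool) → Set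
  MinDegree2 Q = ∀ v → Q v ≡ true → 2 ℕ.≤ deg (χ ∘ Q) v

  -- Deletion of a vertex of degree at most 1 lowers `2 * size` by 2 and the form by at most 2, so
  -- the strict inequality survives. Once no such vertex is left, degrees of at most 2 throughout
  -- would bound the form by `2 * size`.
  dense-core : ∀ k (Q : Fin n → Bool) → size (χ ∘ Q) ℕ.≤ k →
               2 * size (χ ∘ Q) ℕ.< ⟨ χ ∘ Q , χ ∘ Q ⟩ →
               ∃[ Q′ ] (MinDegree2 Q′ × ∃[ z ] (Q′ z ≡ true × 3 ℕ.≤ deg (χ ∘ Q′) z))
  dense-core k Q fuel dense
    with FinP.any? (λ v → (Q v BoolP.≟ true) ×-dec (deg (χ ∘ Q) v ℕ.≤? 1))
  ... | no none
      with FinP.any? (λ v → (Q v BoolP.≟ true) ×-dec (3 ℕ.≤? deg (χ ∘ Q) v))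
  ...   | yes (z , Qz , d≥3) = Q , (λ v Qv → ℕP.≰⇒> λ d≤1 → none (v , Qv , d≤1)) , z , Qz , d≥3
  ...   | no  small = ⊥-elim (ℕP.<⇒≱ dense (begin
            ∑ V (λ u → χ (Q u) * deg (χ ∘ Q) u) ≤⟨ ∑-mono V (λ u _ → bound u) ⟩
            ∑ V (λ u → 2 * χ (Q u))             ≡⟨ ∑-*ˡ 2 _ V ⟩
            2 * size (χ ∘ Q)                    ∎))
          where
          open ℕP.≤-Reasoning
          bound : ∀ u → χ (Q u) * deg (χ ∘ Q) u ℕ.≤ 2 * χ (Q u)
          bound u with Q u in Qu
          ... | false = z≤n
          ... | true  = ℕP.≤-trans (ℕP.≤-reflexive (ℕP.*-identityˡ _))
                          (ℕP.≤-pred (ℕP.≰⇒> λ d≥3 → small (u , Qu , d≥3)))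
  dense-core k Q fuel dense | yes (w , Qw , d≤1) = next k fuel
    where
    Q′ : Fin n → Bool
    Q′ = remove w Q
    χQ : ∀ v → χ (Q v) ≡ χ (Q′ v) + δ w v
    χQ = remove-χ Qw
    size′ : size (χ ∘ Q) ≡ suc (size (χ ∘ Q′))
    size′ = size-insert χQ
    deg≤1 : deg (χ ∘ Q′) w ℕ.≤ 1
    deg≤1 = ℕP.≤-trans (ℕP.≤-trans (ℕP.m≤m+n _ (deg (δ w) w))
              (ℕP.≤-reflexive (sym (trans (deg-cong χQ w) (deg-⊕ (χ ∘ Q′) (δ w) w))))) d≤1
    dense′ : 2 * size (χ ∘ Q′) ℕ.< ⟨ χ ∘ Q′ , χ ∘ Q′ ⟩
    dense′ = ℕP.+-cancelʳ-< 2 _ _ (begin-strict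
      2 * size (χ ∘ Q′) + 2                       ≡⟨ ℕP.+-comm (2 * size (χ ∘ Q′)) 2 ⟩
      2 + 2 * size (χ ∘ Q′)                       ≡⟨ ℕP.*-suc 2 (size (χ ∘ Q′)) ⟨
      2 * suc (size (χ ∘ Q′))                     ≡⟨ cong (2 *_) size′ ⟨
      2 * size (χ ∘ Q)                            <⟨ dense ⟩
      ⟨ χ ∘ Q , χ ∘ Q ⟩                           ≡⟨ ⟨⟩-cong χQ χQ ⟩
      ⟨ (χ ∘ Q′) ⊕ δ w , (χ ∘ Q′) ⊕ δ w ⟩         ≡⟨ insert-deg (χ ∘ Q′) w ⟩
      ⟨ χ ∘ Q′ , χ ∘ Q′ ⟩ + 2 * deg (χ ∘ Q′) w    ≤⟨ ℕP.+-monoʳ-≤ ⟨ χ ∘ Q′ , χ ∘ Q′ ⟩ (ℕP.*-monoʳ-≤ 2 deg≤1) ⟩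
      ⟨ χ ∘ Q′ , χ ∘ Q′ ⟩ + 2                     ∎)
      where open ℕP.≤-Reasoning
    next : ∀ k → size (χ ∘ Q) ℕ.≤ k → _
    next zero fuel with ℕP.≤-trans (ℕP.≤-reflexive (sym size′)) fuel
    ... | ()
    next (suc k) fuel = dense-core k Q′ (ℕP.≤-pred (ℕP.≤-trans (ℕP.≤-reflexive (sym size′)) fuel)) dense′

  Neighbour : (Fin n → Bool) → Fin n → Fin n → Set
  Neighbour Q u v = Q v ≡ true × E u v ≡ true

  another-neighbour : ∀ Q u → 2 ℕ.≤ deg (χ ∘ Q) u → ∀ p → ∃[ v ] (Neighbour Q u v × v ≢ p)
  another-neighbour Q u d≥2 p
    with FinP.any? (λ v → ((Q v BoolP.≟ true) ×-dec (E u v BoolP.≟ true)) ×-dec (¬? (v FinP.≟ p)))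
  ... | yes found = found
  ... | no  none  = ⊥-elim (ℕP.<⇒≱ d≥2 (ℕP.≤-trans (∑-mono V λ v _ → bound v) (ℕP.≤-reflexive (size-δ p))))
    where
    bound : ∀ v → χ (Q v) * a u v ℕ.≤ δ p v
    bound v with Q v in Qv | E u v in Euv | v FinP.≟ p
    ... | false | _     | _      = z≤n
    ... | true  | false | _      = z≤n
    ... | true  | true  | yes _  = ℕP.≤-refl
    ... | true  | true  | no v≢p = ⊥-elim (none (v , (Qv , Euv) , v≢p))

  third-neighbour : ∀ Q u → 3 ℕ.≤ deg (χ ∘ Q) u → ∀ p r → ∃[ v ] (Neighbour Q u v × v ≢ p × v ≢ r)
  third-neighbour Q u d≥3 p r
    with FinP.any? (λ v → ((Q v BoolP.≟ true) ×-dec (E u v BoolP.≟ true)) ×-dec (¬? (v FinP.≟ p) ×-dec ¬? (v FinP.≟ r)))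
  ... | yes found = found
  ... | no  none  = ⊥-elim (ℕP.<⇒≱ d≥3 (ℕP.≤-trans (∑-mono V λ v _ → bound v)
                      (ℕP.≤-reflexive (trans (∑-+ (δ p) (δ r) V) (cong₂ _+_ (size-δ p) (size-δ r))))))
    where
    bound : ∀ v → χ (Q v) * a u v ℕ.≤ δ p v + δ r v
    bound v with Q v in Qv | E u v in Euv | v FinP.≟ p | v FinP.≟ r
    ... | false | _     | _      | _      = z≤n
    ... | true  | false | _      | _      = z≤n
    ... | true  | true  | yes _  | _      = s≤s z≤n
    ... | true  | true  | no _   | yes _  = ℕP.≤-refl
    ... | true  | true  | no v≢p | no v≢r = ⊥-elim (none (v , (Qv , Euv) , v≢p , v≢r))

⌊⌋-true : ∀ {P : Set} (P? : Dec P) → P → ⌊ P? ⌋ ≡ true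
⌊⌋-true (yes _) _ = refl
⌊⌋-true (no ¬p) p = ⊥-elim (¬p p)

⌊⌋-true⁻ : ∀ {P : Set} (P? : Dec P) → ⌊ P? ⌋ ≡ true → P
⌊⌋-true⁻ (yes p) _ = p

⌊⌋-false : ∀ {P : Set} (P? : Dec P) → ¬ P → ⌊ P? ⌋ ≡ false
⌊⌋-false (yes p) ¬p = ⊥-elim (¬p p)
⌊⌋-false (no _)  _  = refl

module ClientGraph {n : ℕ} (C : List (Edge n)) (C⊆ : ∀ e → e ∈ C → e ∈ allEdges n) where

  open DecMembership (_≟E_ {n}) using (_∈?_)

  adjacent : Fin n → Fin n → Bool
  adjacent u v = ⌊ mkEdge u v ∈? C ⌋

  adjacent-sym : ∀ u v → adjacent u v ≡ adjacent v u
  adjacent-sym u v = cong (λ e → ⌊ e ∈? C ⌋) (mkEdge-comm u v)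

  adjacent-irrefl : ∀ u → adjacent u u ≡ false
  adjacent-irrefl u = ⌊⌋-false (mkEdge u u ∈? C) λ uu∈ →
    ℕP.<-irrefl refl (allEdges-ordered (subst (_∈ allEdges n) loop (C⊆ _ uu∈)))
    where
    loop : mkEdge u u ≡ (u , u)
    loop with mkEdge-cases u u
    ... | inj₁ p = p
    ... | inj₂ p = p

  Adj⇒adjacent : ∀ {u v} → Adj C u v → adjacent u v ≡ true
  Adj⇒adjacent {u} {v} uv = ⌊⌋-true (mkEdge u v ∈? C) (Adj⇒mkEdge∈ C⊆ uv)

  open DegreeSums adjacent adjacent-sym adjacent-irrefl public

  walk-crosses : ∀ {P : Fin n → Set} (T : Fin n → Bool) {u w} → Walk C P u w → T u ≡ true → T w ≡ false →
    ∃[ u′ ] ∃[ w′ ] (T u′ ≡ true × T w′ ≡ false × P w′ × adjacent w′ u′ ≡ true)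
  walk-crosses T here Tu Tw with trans (sym Tu) Tw
  ... | ()
  walk-crosses T {u} (step {w = v} uv Pv rest) Tu Tw with T v in Tv
  ... | true  = walk-crosses T rest Tv Tw
  ... | false = u , v , Tu , Tv , Pv , Adj⇒adjacent (Adj-sym uv)

  -- The branch sets span at least |B_i| - 1 edges each and six further edges join them: at least
  -- |Q| - 4 + 6 edges on |Q| vertices.
  K₄-dense : HasMinor 4 C → ∃[ Q ] (2 * size (χ ∘ Q) ℕ.< ⟨ χ ∘ Q , χ ∘ Q ⟩)
  K₄-dense (branch , nonempty , connected , linked) = (λ v → is-just (branch v)) , dense
    where
    _≟M_ : DecidableEquality (Maybe (Fin 4))
    _≟M_ = MaybeP.≡-dec FinP._≟_
    B : Fin 4 → Fin n → Bool
    B i v = ⌊ branch v ≟M just i ⌋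
    x : Fin 4 → Fin n → ℕ
    x i = χ ∘ B i
    S : Fin n → ℕ
    S = ((x 0F ⊕ x 1F) ⊕ x 2F) ⊕ x 3F
    inB : ∀ {i v} → branch v ≡ just i → B i v ≡ true
    inB {i} {v} = ⌊⌋-true (branch v ≟M just i)
    inB⁻ : ∀ {i v} → B i v ≡ true → branch v ≡ just i
    inB⁻ {i} {v} = ⌊⌋-true⁻ (branch v ≟M just i)
    χ≡S : ∀ v → χ (is-just (branch v)) ≡ S v
    χ≡S v with branch v
    ... | nothing = refl
    ... | just 0F = refl
    ... | just 1F = refl
    ... | just 2F = refl
    ... | just 3F = refl
    tree : ∀ i → 2 * size (x i) ℕ.≤ ⟨ x i , x i ⟩ + 2
    tree i = connected-deg (B i) cross (proj₁ (nonempty i)) (inB (proj₂ (nonempty i)))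
      where
      cross : (T : Fin n → Bool) → ∀ u w → T u ≡ true → T w ≡ false → B i u ≡ true → B i w ≡ true →
        ∃[ u′ ] ∃[ w′ ] (T u′ ≡ true × T w′ ≡ false × B i w′ ≡ true × adjacent w′ u′ ≡ true)
      cross T u w Tu Tw Bu Bw =
        let u′ , w′ , Tu′ , Tw′ , Bw′ , edge = walk-crosses T (connected i u w (inB⁻ Bu) (inB⁻ Bw)) Tu Tw
        in u′ , w′ , Tu′ , Tw′ , inB Bw′ , edge
    link : ∀ i j → i Fin.< j → 1 ℕ.≤ ⟨ x i , x j ⟩
    link i j i<j =
      let u , v , Bu , Bv , uv = linked i j i<j in
      ℕP.≤-trans (deg-mono-edge {B j} {v} {u} (inB Bv) (Adj⇒adjacent uv))
        (ℕP.≤-trans (ℕP.≤-reflexive (sym (trans (cong (λ b → χ b * deg (x j) u) (inB Bu)) (ℕP.*-identityˡ _))))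
          (term≤∑ (λ u → x i u * deg (x j) u) V (∈-allFin u)))
    link′ : ∀ i j → j Fin.< i → 1 ℕ.≤ ⟨ x i , x j ⟩
    link′ i j j<i = subst (1 ℕ.≤_) (⟨⟩-comm (x j) (x i)) (link j i j<i)
    row : ∀ i → ⟨ x i , S ⟩ ≡ ⟨ x i , x 0F ⟩ + ⟨ x i , x 1F ⟩ + ⟨ x i , x 2F ⟩ + ⟨ x i , x 3F ⟩
    row i = trans (⟨⟩-⊕ʳ (x i) ((x 0F ⊕ x 1F) ⊕ x 2F) (x 3F)) (cong (_+ ⟨ x i , x 3F ⟩)
            (trans (⟨⟩-⊕ʳ (x i) (x 0F ⊕ x 1F) (x 2F)) (cong (_+ ⟨ x i , x 2F ⟩) (⟨⟩-⊕ʳ (x i) (x 0F) (x 1F)))))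
    sum-bound : ∀ {s p b c d} → s ℕ.≤ p + 2 → 1 ℕ.≤ b → 1 ℕ.≤ c → 1 ℕ.≤ d → s + 1 ℕ.≤ p + b + c + d
    sum-bound {s} {p} {b} {c} {d} s≤ 1≤b 1≤c 1≤d = begin
      s + 1         ≤⟨ ℕP.+-monoˡ-≤ 1 s≤ ⟩
      p + 2 + 1     ≡⟨ regroup p ⟩
      p + 1 + 1 + 1 ≤⟨ ℕP.+-mono-≤ (ℕP.+-mono-≤ (ℕP.+-monoʳ-≤ p 1≤b) 1≤c) 1≤d ⟩
      p + b + c + d ∎
      where
      open ℕP.≤-Reasoning
      regroup : ∀ p → p + 2 + 1 ≡ p + 1 + 1 + 1
      regroup = solve-∀
    swap₁ : ∀ p b c d → p + b + c + d ≡ b + p + c + d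
    swap₁ = solve-∀
    swap₂ : ∀ p b c d → p + b + c + d ≡ b + c + p + d
    swap₂ = solve-∀
    swap₃ : ∀ p b c d → p + b + c + d ≡ b + c + d + p
    swap₃ = solve-∀
    -- Per branch set the tree bound loses 2 and the three links gain 3; the four surplus units give
    -- strictness.
    row-bound : ∀ i → 2 * size (x i) + 1 ℕ.≤ ⟨ x i , S ⟩
    row-bound i = subst (2 * size (x i) + 1 ℕ.≤_) (sym (row i)) (bound i)
      where
      bound : ∀ i → 2 * size (x i) + 1 ℕ.≤ ⟨ x i , x 0F ⟩ + ⟨ x i , x 1F ⟩ + ⟨ x i , x 2F ⟩ + ⟨ x i , x 3F ⟩
      bound 0F = sum-bound {p = ⟨ x 0F , x 0F ⟩} (tree 0F) (link 0F 1F (s≤s z≤n)) (link 0F 2F (s≤s z≤n)) (link 0F 3F (s≤s z≤n))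
      bound 1F = subst (2 * size (x 1F) + 1 ℕ.≤_) (swap₁ ⟨ x 1F , x 1F ⟩ ⟨ x 1F , x 0F ⟩ ⟨ x 1F , x 2F ⟩ ⟨ x 1F , x 3F ⟩)
        (sum-bound {p = ⟨ x 1F , x 1F ⟩} (tree 1F) (link′ 1F 0F (s≤s z≤n)) (link 1F 2F (s≤s (s≤s z≤n))) (link 1F 3F (s≤s (s≤s z≤n))))
      bound 2F = subst (2 * size (x 2F) + 1 ℕ.≤_) (swap₂ ⟨ x 2F , x 2F ⟩ ⟨ x 2F , x 0F ⟩ ⟨ x 2F , x 1F ⟩ ⟨ x 2F , x 3F ⟩)
        (sum-bound {p = ⟨ x 2F , x 2F ⟩} (tree 2F) (link′ 2F 0F (s≤s z≤n)) (link′ 2F 1F (s≤s (s≤s z≤n))) (link 2F 3F (s≤s (s≤s (s≤s z≤n)))))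
      bound 3F = subst (2 * size (x 3F) + 1 ℕ.≤_) (swap₃ ⟨ x 3F , x 3F ⟩ ⟨ x 3F , x 0F ⟩ ⟨ x 3F , x 1F ⟩ ⟨ x 3F , x 2F ⟩)
        (sum-bound {p = ⟨ x 3F , x 3F ⟩} (tree 3F) (link′ 3F 0F (s≤s z≤n)) (link′ 3F 1F (s≤s (s≤s z≤n))) (link′ 3F 2F (s≤s (s≤s (s≤s z≤n)))))
    size-S : size S ≡ size (x 0F) + size (x 1F) + size (x 2F) + size (x 3F)
    size-S = trans (∑-+ _ (x 3F) V) (cong (_+ size (x 3F))
             (trans (∑-+ _ (x 2F) V) (cong (_+ size (x 2F)) (∑-+ (x 0F) (x 1F) V))))
    columns : ⟨ S , S ⟩ ≡ ⟨ x 0F , S ⟩ + ⟨ x 1F , S ⟩ + ⟨ x 2F , S ⟩ + ⟨ x 3F , S ⟩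
    columns = trans (⟨⟩-⊕ˡ ((x 0F ⊕ x 1F) ⊕ x 2F) (x 3F) S) (cong (_+ ⟨ x 3F , S ⟩)
              (trans (⟨⟩-⊕ˡ (x 0F ⊕ x 1F) (x 2F) S) (cong (_+ ⟨ x 2F , S ⟩) (⟨⟩-⊕ˡ (x 0F) (x 1F) S))))
    dense : 2 * size (λ v → χ (is-just (branch v))) ℕ.< ⟨ (λ v → χ (is-just (branch v))) , (λ v → χ (is-just (branch v))) ⟩
    dense = subst₂ (λ s d → 2 * s ℕ.< d) (sym (∑-cong V λ v _ → χ≡S v)) (sym (⟨⟩-cong χ≡S χ≡S)) (begin-strict
      2 * size S ≡⟨ cong (2 *_) size-S ⟩
      2 * (size (x 0F) + size (x 1F) + size (x 2F) + size (x 3F))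
        <⟨ ℕP.m<m+n _ {4} (s≤s z≤n) ⟩
      2 * (size (x 0F) + size (x 1F) + size (x 2F) + size (x 3F)) + 4
        ≡⟨ regroup (size (x 0F)) (size (x 1F)) (size (x 2F)) (size (x 3F)) ⟩
      (2 * size (x 0F) + 1) + (2 * size (x 1F) + 1) + (2 * size (x 2F) + 1) + (2 * size (x 3F) + 1)
        ≤⟨ ℕP.+-mono-≤ (ℕP.+-mono-≤ (ℕP.+-mono-≤ (row-bound 0F) (row-bound 1F)) (row-bound 2F)) (row-bound 3F) ⟩
      ⟨ x 0F , S ⟩ + ⟨ x 1F , S ⟩ + ⟨ x 2F , S ⟩ + ⟨ x 3F , S ⟩ ≡⟨ columns ⟨
      ⟨ S , S ⟩ ∎)
      where
      open ℕP.≤-Reasoning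
      regroup : ∀ a b c d → 2 * (a + b + c + d) + 4 ≡ (2 * a + 1) + (2 * b + 1) + (2 * c + 1) + (2 * d + 1)
      regroup = solve-∀

-- Paths as vertex sequences, and handcuffs

module _ {n : ℕ} where

  pathEdges : List (Fin n) → List (Edge n)
  pathEdges []           = []
  pathEdges (x ∷ [])     = []
  pathEdges (x ∷ y ∷ ys) = mkEdge x y ∷ pathEdges (y ∷ ys)

  lastOf : Fin n → List (Fin n) → Fin n
  lastOf x []       = x
  lastOf x (y ∷ ys) = lastOf y ys

  lastOf∈ : ∀ x xs → lastOf x xs ∈ x ∷ xs
  lastOf∈ x []       = here refl
  lastOf∈ x (y ∷ ys) = there (lastOf∈ y ys)

  pathEdges-ends : ∀ {a b} xs → mkEdge a b ∈ pathEdges xs → a ∈ xs × b ∈ xs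
  pathEdges-ends (x ∷ y ∷ ys) (here eq) with mkEdge-injective eq
  ... | inj₁ (refl , refl) = here refl , there (here refl)
  ... | inj₂ (refl , refl) = there (here refl) , here refl
  pathEdges-ends (x ∷ y ∷ ys) (there e∈) =
    let a∈ , b∈ = pathEdges-ends (y ∷ ys) e∈ in there a∈ , there b∈

  -- Serves to show that a chord from an end of the path to any vertex but its path neighbour is a
  -- new edge.
  pathEdges-head : ∀ {x y ys u} → Unique (x ∷ y ∷ ys) → mkEdge x u ∈ pathEdges (x ∷ y ∷ ys) → u ≡ y
  pathEdges-head ((x≢y ∷ _) ∷ _) (here eq) with mkEdge-injective eq
  ... | inj₁ (_ , u≡y) = u≡y
  ... | inj₂ (x≡y , _) = ⊥-elim (x≢y x≡y)
  pathEdges-head {y = y} {ys} uniq (there e∈) =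
    ⊥-elim (Unique[x∷xs]⇒x∉xs uniq (proj₁ (pathEdges-ends (y ∷ ys) e∈)))

  pathEdges-unique : ∀ {xs} → Unique xs → Unique (pathEdges xs)
  pathEdges-unique []       = []
  pathEdges-unique (_ ∷ []) = []
  pathEdges-unique {x ∷ y ∷ ys} (x∉ ∷ u@(_ ∷ _)) =
    ∉⇒All≢ _ (λ e∈ → Unique[x∷xs]⇒x∉xs (x∉ ∷ u) (proj₁ (pathEdges-ends (y ∷ ys) e∈)))
    ∷ pathEdges-unique u

  -- Accumulator form of the fact that a reversed path has the same edges: each step of `ʳ++` moves
  -- one edge from the left part to the right part.
  pathEdges-ʳ++ : ∀ {e} xs x ys → e ∈ pathEdges (xs ʳ++ (x ∷ ys)) →
                  e ∈ pathEdges (x ∷ xs) ⊎ e ∈ pathEdges (x ∷ ys)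
  pathEdges-ʳ++ []       x ys e∈ = inj₂ e∈
  pathEdges-ʳ++ (y ∷ xs) x ys e∈ with pathEdges-ʳ++ xs y (x ∷ ys) e∈
  ... | inj₁ e∈xs          = inj₁ (there e∈xs)
  ... | inj₂ (here refl)   = inj₁ (here (mkEdge-comm y x))
  ... | inj₂ (there e∈ys)  = inj₂ e∈ys

  linked-ʳ++ : ∀ {R : Fin n → Fin n → Set} → (∀ {u v} → R u v → R v u) → ∀ xs {x ys} →
               Linked R (x ∷ xs) → Linked R (x ∷ ys) → Linked R (xs ʳ++ (x ∷ ys))
  linked-ʳ++ R-sym []       _          xys = xys
  linked-ʳ++ R-sym (y ∷ xs) (Rxy ∷ yxs) xys = linked-ʳ++ R-sym xs yxs (R-sym Rxy ∷ xys)

  ʳ++-shape : ∀ xs x ys → ∃[ zs ] (xs ʳ++ (x ∷ ys) ≡ lastOf x xs ∷ zs × lastOf (lastOf x xs) zs ≡ lastOf x ys)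
  ʳ++-shape []       x ys = ys , refl , refl
  ʳ++-shape (y ∷ xs) x ys = ʳ++-shape xs y (x ∷ ys)

  -- One more edge than vertices, yet only polynomially many per vertex sequence.
  handcuff : Fin n → List (Fin n) → Fin n → Fin n → List (Edge n)
  handcuff x xs u v = mkEdge x u ∷ mkEdge (lastOf x xs) v ∷ pathEdges (x ∷ xs)

  -- Distinctness of the whole edge list is what secures the surplus edge: both chords lie off the
  -- path and differ from each other. It excludes a mere cycle, where both would be the closing
  -- edge.
  ContainsHandcuff : List (Edge n) → Set
  ContainsHandcuff C = ∃[ x ] ∃[ xs ] ∃[ u ] ∃[ v ]
    (Unique (x ∷ xs) × u ∈ x ∷ xs × v ∈ x ∷ xs × Unique (handcuff x xs u v)
     × (∀ e → e ∈ handcuff x xs u v → e ∈ C))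

-- Finding a handcuff by extending a path at both ends

module FindHandcuff {n : ℕ} (C : List (Edge n)) (C⊆ : ∀ e → e ∈ C → e ∈ allEdges n) where

  open ClientGraph C C⊆
  open DecMembership (FinP._≟_ {n}) using (_∈?_)

  _~_ : Fin n → Fin n → Set
  u ~ v = adjacent u v ≡ true

  ~-sym : ∀ {u v} → u ~ v → v ~ u
  ~-sym {u} {v} uv = trans (adjacent-sym v u) uv

  ~⇒∈ : ∀ {u v} → u ~ v → mkEdge u v ∈ C
  ~⇒∈ {u} {v} = ⌊⌋-true⁻ (DecMembership._∈?_ _≟E_ (mkEdge u v) C)

  linked⇒⊆ : ∀ {xs} → Linked _~_ xs → ∀ e → e ∈ pathEdges xs → e ∈ C
  linked⇒⊆ (uv ∷ _)    _ (here refl) = ~⇒∈ uv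
  linked⇒⊆ (_ ∷ lnk)   e (there e∈)  = linked⇒⊆ lnk e e∈

  module _ (Q : Fin n → Bool) (min2 : MinDegree2 Q) where

    -- The invariant is a parameter because the extension is run twice: on plain paths, and on paths
    -- that already carry a chord at the far end. The fuel suffices since a path has at most n
    -- vertices.
    extend-maximally : (Inv : Fin n → List (Fin n) → Set) →
      (∀ {x xs} → Inv x xs → Unique (x ∷ xs)) →
      (∀ {x xs w} → Inv x xs → Neighbour Q x w → w ∉ x ∷ xs → Inv w (x ∷ xs)) →
      ∀ k {x xs} → n ℕ.≤ length xs + k → Inv x xs →
      ∃[ y ] ∃[ ys ] (Inv y ys × (∀ w → Neighbour Q y w → w ∈ y ∷ ys))
    extend-maximally Inv inv-unique inv-step k {x} {xs} fuel inv
      with FinP.any? (λ w → ((Q w BoolP.≟ true) ×-dec (adjacent x w BoolP.≟ true)) ×-dec ¬? (w ∈? (x ∷ xs)))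
    ... | no stuck = x , xs , inv , inside
      where
      inside : ∀ w → Neighbour Q x w → w ∈ x ∷ xs
      inside w nb with w ∈? (x ∷ xs)
      ... | yes w∈ = w∈
      ... | no  w∉ = ⊥-elim (stuck (w , nb , w∉))
    ... | yes (w , nb , w∉) = next k fuel
      where
      next : ∀ k → n ℕ.≤ length xs + k → _
      next zero fuel = ⊥-elim (ℕP.<⇒≱ (ℕP.≤-trans
          (unique-⊆⇒length≤ {ys = allFin n} (inv-unique inv) (λ y _ → ∈-allFin y))
          (ℕP.≤-reflexive (ListP.length-tabulate (λ i → i))))
        (ℕP.≤-trans fuel (ℕP.≤-reflexive (ℕP.+-identityʳ _))))
      next (suc k) fuel = extend-maximally Inv inv-unique inv-step k
        (ℕP.≤-trans fuel (ℕP.≤-reflexive (ℕP.+-suc _ k))) (inv-step inv nb w∉)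

    record PathTo (z x : Fin n) (xs : List (Fin n)) : Set where
      field
        linked : Linked _~_ (x ∷ xs)
        unique : Unique (x ∷ xs)
        inside : Q x ≡ true
        ending : lastOf x xs ≡ z

    open PathTo

    extend-path : ∀ {z x xs w} → PathTo z x xs → Neighbour Q x w → w ∉ x ∷ xs → PathTo z w (x ∷ xs)
    extend-path path (Qw , xw) w∉ = record
      { linked = ~-sym xw ∷ linked path
      ; unique = ∉⇒All≢ _ w∉ ∷ unique path
      ; inside = Qw
      ; ending = ending path }

    -- The path from `z` gets stuck at some `y`, where minimum degree 2 gives a chord to `r`. At `z`
    -- the third neighbour `w` differs from the path neighbour and from `y`, so the edge from `z` to
    -- `w` is neither a path edge nor that chord, even if `r` is `z` and the path closes to a cycle.
    -- If `w` lies on the path, both chords are found; otherwise the path grows beyond `z`, and its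
    -- new end is neither `y` nor `r`, so its own chord is again a different edge.
    from-cubic-vertex : ∀ z → Q z ≡ true → 3 ℕ.≤ deg (χ ∘ Q) z → ContainsHandcuff C
    from-cubic-vertex z Qz d≥3 =
      let y , ys , path , maximal = extend-maximally (PathTo z) unique extend-path n (ℕP.≤-refl)
            (record { linked = [-] ; unique = [] ∷ [] ; inside = Qz ; ending = refl })
      in first-end y ys path maximal
      where
      closing : ∀ y y₁ ys → PathTo z y (y₁ ∷ ys) → ∀ r → r ∈ y ∷ y₁ ∷ ys → y ~ r → r ≢ y₁ →
                ∀ zs → reverse (y ∷ y₁ ∷ ys) ≡ z ∷ zs → lastOf z zs ≡ y → ContainsHandcuff C
      closing y y₁ ys path r r∈ yr r≢y₁ [] _ z≡y =
        ⊥-elim (Unique[x∷xs]⇒x∉xs (unique path)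
          (subst (_∈ y₁ ∷ ys) (trans (ending path) z≡y) (lastOf∈ y₁ ys)))
      closing y y₁ ys path r r∈ yr r≢y₁ (z₁ ∷ zs) rev≡ last≡y = found
        where
        R : List (Fin n)
        R = z ∷ z₁ ∷ zs
        R-linked : Linked _~_ R
        R-linked = subst (Linked _~_) rev≡ (linked-ʳ++ ~-sym (y₁ ∷ ys) (linked path) [-])
        R-unique : Unique R
        R-unique = subst Unique rev≡
          (Unique-resp-↭ (setoid (Fin n)) (↭⇒↭ₛ (↭-sym (↭-reverse (y ∷ y₁ ∷ ys)))) (unique path))
        to-R : ∀ {v} → v ∈ y ∷ y₁ ∷ ys → v ∈ R
        to-R v∈ = subst (_ ∈_) rev≡ (reverse⁺ v∈)
        y∈R : y ∈ R
        y∈R = to-R (here refl)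
        z≢y : z ≢ y
        z≢y z≡y = Unique[x∷xs]⇒x∉xs R-unique
          (subst (_∈ z₁ ∷ zs) (trans last≡y (sym z≡y)) (lastOf∈ z₁ zs))
        chord : Edge n
        chord = mkEdge y r
        chord∉R : chord ∉ pathEdges R
        chord∉R c∈ with pathEdges-ʳ++ (y₁ ∷ ys) y [] (subst (λ zs → chord ∈ pathEdges zs) (sym rev≡) c∈)
        ... | inj₁ c∈P = r≢y₁ (pathEdges-head (unique path) c∈P)
        ... | inj₂ ()
        -- Keeping both ends of `chord` behind the growing end makes it differ from every edge added
        -- later at that end.
        record Extended (x : Fin n) (xs : List (Fin n)) : Set where
          field
            path′   : PathTo y x xs
            fresh   : chord ∉ pathEdges (x ∷ xs)
            y-inner : y ∈ xs
            r-inner : r ∈ xs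
        open Extended
        extend : ∀ {x xs w} → Extended x xs → Neighbour Q x w → w ∉ x ∷ xs → Extended w (x ∷ xs)
        extend {x} {xs} {w} ext nb w∉ = record
          { path′   = extend-path (path′ ext) nb w∉
          ; fresh   = fresh′
          ; y-inner = there (y-inner ext)
          ; r-inner = there (r-inner ext) }
          where
          fresh′ : chord ∉ pathEdges (w ∷ x ∷ xs)
          fresh′ (there c∈) = fresh ext c∈
          fresh′ (here eq) with mkEdge-injective eq
          ... | inj₁ (refl , _) = w∉ (there (y-inner ext))
          ... | inj₂ (_ , refl) = w∉ (there (r-inner ext))
        second-end : ∀ x xs → Extended x xs → (∀ w → Neighbour Q x w → w ∈ x ∷ xs) → ContainsHandcuff C
        second-end x []        ext _ with y-inner ext
        ... | ()
        second-end x (x₁ ∷ xs) ext maximal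
          with another-neighbour Q x (min2 x (inside (path′ ext))) x₁
        ... | t , (Qt , xt) , t≢x₁ = x , x₁ ∷ xs , t , r , uniq , maximal t (Qt , xt)
              , there (r-inner ext) , distinct , within
          where
          uniq = unique (path′ ext)
          last≡ = ending (path′ ext)
          distinct : Unique (handcuff x (x₁ ∷ xs) t r)
          -- After the rewrite the second edge of the handcuff is `chord`.
          distinct rewrite last≡ = ∉⇒All≢ _ xt∉ ∷ ∉⇒All≢ _ (fresh ext) ∷ pathEdges-unique uniq
            where
            xt∉ : mkEdge x t ∉ chord ∷ pathEdges (x ∷ x₁ ∷ xs)
            xt∉ (there e∈) = t≢x₁ (pathEdges-head uniq e∈)
            xt∉ (here eq) with mkEdge-injective eq
            ... | inj₁ (refl , _) = Unique[x∷xs]⇒x∉xs uniq (y-inner ext)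
            ... | inj₂ (refl , _) = Unique[x∷xs]⇒x∉xs uniq (r-inner ext)
          within : ∀ e → e ∈ handcuff x (x₁ ∷ xs) t r → e ∈ C
          within e e∈ rewrite last≡ with e∈
          ... | here refl         = ~⇒∈ xt
          ... | there (here refl) = ~⇒∈ yr
          ... | there (there e∈P) = linked⇒⊆ (linked (path′ ext)) e e∈P
        found : ContainsHandcuff C
        found with third-neighbour Q z d≥3 z₁ y
        ... | w , (Qw , zw) , w≢z₁ , w≢y with w ∈? R
        ... | yes w∈R = z , z₁ ∷ zs , w , r , R-unique , w∈R , to-R r∈ , distinct , within
          where
          distinct : Unique (handcuff z (z₁ ∷ zs) w r)
          distinct rewrite last≡y = ∉⇒All≢ _ zw∉ ∷ ∉⇒All≢ _ chord∉R ∷ pathEdges-unique R-unique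
            where
            zw∉ : mkEdge z w ∉ chord ∷ pathEdges R
            zw∉ (there e∈) = w≢z₁ (pathEdges-head R-unique e∈)
            zw∉ (here eq) with mkEdge-injective eq
            ... | inj₁ (z≡y , _) = z≢y z≡y
            ... | inj₂ (_ , w≡y) = w≢y w≡y
          within : ∀ e → e ∈ handcuff z (z₁ ∷ zs) w r → e ∈ C
          within e e∈ rewrite last≡y with e∈
          ... | here refl         = ~⇒∈ zw
          ... | there (here refl) = ~⇒∈ yr
          ... | there (there e∈P) = linked⇒⊆ R-linked e e∈P
        ... | no w∉R =
          let x , xs , ext , maximal = extend-maximally Extended (unique ∘ path′) extend n (ℕP.m≤n+m n _) start
          in second-end x xs ext maximal
          where
          R-path : PathTo y z (z₁ ∷ zs)
          R-path = record { linked = R-linked ; unique = R-unique ; inside = Qz ; ending = last≡y }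
          start : Extended w R
          start = record
            { path′   = extend-path R-path (Qw , zw) w∉R
            ; fresh   = fresh′
            ; y-inner = y∈R
            ; r-inner = to-R r∈ }
            where
            fresh′ : chord ∉ pathEdges (w ∷ R)
            fresh′ (there c∈) = chord∉R c∈
            fresh′ (here eq) with mkEdge-injective eq
            ... | inj₁ (refl , _) = w∉R y∈R
            ... | inj₂ (_ , refl) = w∉R (to-R r∈)
      first-end : ∀ y ys → PathTo z y ys → (∀ w → Neighbour Q y w → w ∈ y ∷ ys) → ContainsHandcuff C
      first-end y [] path maximal with another-neighbour Q y (min2 y (inside path)) y
      ... | r , nb , r≢y with maximal r nb
      ... | here r≡y = ⊥-elim (r≢y r≡y)
      first-end y (y₁ ∷ ys) path maximal with another-neighbour Q y (min2 y (inside path)) y₁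
      ... | r , (Qr , yr) , r≢y₁ with ʳ++-shape (y₁ ∷ ys) y []
      ... | zs , rev≡ , last≡y rewrite ending path =
        closing y y₁ ys path r (maximal r (Qr , yr)) yr r≢y₁ zs rev≡ last≡y

  K₄-minor⇒handcuff : HasMinor 4 C → ContainsHandcuff C
  K₄-minor⇒handcuff minor =
    let Q , dense = K₄-dense minor
        Q′ , min2 , z , Qz , d≥3 = dense-core (size (χ ∘ Q)) Q ℕP.≤-refl dense
    in from-cubic-vertex Q′ min2 z Qz d≥3

-- Counting handcuffs

module WeightedGeometricSums (n d : ℕ) where

  N : ℕ
  N = n + d

  -- hᵢ L = Σ_{k ≤ L} cᵢ(k) n^k N^(L−k) with c₁ = 1, c₂ = k + 1, c₃ = (k + 1)(k + 2).
  h₁ h₂ h₃ : ℕ → ℕ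
  h₁ zero    = 1
  h₁ (suc L) = N * h₁ L + n ^ suc L
  h₂ zero    = 1
  h₂ (suc L) = N * h₂ L + (2 + L) * n ^ suc L
  h₃ zero    = 2
  h₃ (suc L) = N * h₃ L + (2 + L) * (3 + L) * n ^ suc L

  -- Multiplying by d = N - n differences the coefficients and leaves a boundary term at the top.
  -- Here and in the next two identities, c₁ becomes zero beyond its first entry, c₂ becomes c₁, and
  -- c₃ becomes 2 c₂.
  h₁-telescopes : ∀ L → d * h₁ L + n ^ suc L ≡ N ^ suc L
  h₁-telescopes zero    = base n d
    where
    base : ∀ n d → d * 1 + n * 1 ≡ (n + d) * 1
    base = solve-∀
  h₁-telescopes (suc L) = trans (advance n d (h₁ L) (n ^ suc L)) (cong (N *_) (h₁-telescopes L))
    where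
    advance : ∀ n d h p → d * ((n + d) * h + p) + n * p ≡ (n + d) * (d * h + p)
    advance = solve-∀

  h₂-telescopes : ∀ L → d * h₂ L + (1 + L) * n ^ suc L ≡ N * h₁ L
  h₂-telescopes zero    = base n d
    where
    base : ∀ n d → d * 1 + (n * 1 + 0) ≡ (n + d) * 1
    base = solve-∀
  h₂-telescopes (suc L) = begin
    d * (N * h₂ L + (2 + L) * n ^ suc L) + (2 + L) * (n * n ^ suc L)
      ≡⟨ advance n d (h₂ L) L (n ^ suc L) ⟩
    N * (d * h₂ L + (1 + L) * n ^ suc L + n ^ suc L)
      ≡⟨ cong (λ s → N * (s + n ^ suc L)) (h₂-telescopes L) ⟩
    N * (N * h₁ L + n ^ suc L) ∎
    where
    open ≡-Reasoning
    advance : ∀ n d h L p → d * ((n + d) * h + (2 + L) * p) + (2 + L) * (n * p)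
                       ≡ (n + d) * (d * h + (1 + L) * p + p)
    advance = solve-∀

  h₃-telescopes : ∀ L → d * h₃ L + (1 + L) * (2 + L) * n ^ suc L ≡ 2 * N * h₂ L
  h₃-telescopes zero    = base n d
    where
    base : ∀ n d → d * 2 + 2 * (n * 1) ≡ 2 * (n + d) * 1
    base = solve-∀
  h₃-telescopes (suc L) = begin
    d * (N * h₃ L + (2 + L) * (3 + L) * n ^ suc L) + (2 + L) * (3 + L) * (n * n ^ suc L)
      ≡⟨ advance n d (h₃ L) L (n ^ suc L) ⟩
    N * (d * h₃ L + (1 + L) * (2 + L) * n ^ suc L) + 2 * N * ((2 + L) * n ^ suc L)
      ≡⟨ cong (λ s → N * s + 2 * N * ((2 + L) * n ^ suc L)) (h₃-telescopes L) ⟩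
    N * (2 * N * h₂ L) + 2 * N * ((2 + L) * n ^ suc L)
      ≡⟨ factor N (h₂ L) ((2 + L) * n ^ suc L) ⟩
    2 * N * (N * h₂ L + (2 + L) * n ^ suc L) ∎
    where
    open ≡-Reasoning
    advance : ∀ n d h L p → d * ((n + d) * h + (2 + L) * (3 + L) * p) + (2 + L) * (3 + L) * (n * p)
                       ≡ (n + d) * (d * h + (1 + L) * (2 + L) * p) + 2 * (n + d) * ((2 + L) * p)
    advance = solve-∀
    factor : ∀ N h r → N * (2 * N * h) + 2 * N * r ≡ 2 * N * (N * h + r)
    factor = solve-∀

  -- Three telescopings with the boundary terms dropped, each at the price of one factor d; hence
  -- the cube in the condition 2N² < d³.
  h₃-bound : ∀ L → d * d * d * h₃ L ℕ.≤ 2 * N * N * N ^ suc L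
  h₃-bound L = begin
    d * d * d * h₃ L          ≡⟨ assoc₁ d (h₃ L) ⟩
    d * d * (d * h₃ L)        ≤⟨ ℕP.*-monoʳ-≤ (d * d) (drop (h₃-telescopes L)) ⟩
    d * d * (2 * N * h₂ L)    ≡⟨ assoc₂ d N (h₂ L) ⟩
    2 * N * d * (d * h₂ L)    ≤⟨ ℕP.*-monoʳ-≤ (2 * N * d) (drop (h₂-telescopes L)) ⟩
    2 * N * d * (N * h₁ L)    ≡⟨ assoc₃ d N (h₁ L) ⟩
    2 * N * N * (d * h₁ L)    ≤⟨ ℕP.*-monoʳ-≤ (2 * N * N) (drop (h₁-telescopes L)) ⟩
    2 * N * N * N ^ suc L     ∎
    where
    open ℕP.≤-Reasoning
    drop : ∀ {a b c} → a + b ≡ c → a ℕ.≤ c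
    drop {a} {b} eq = subst (a ℕ.≤_) eq (ℕP.m≤m+n a b)
    assoc₁ : ∀ d h → d * d * d * h ≡ d * d * (d * h)
    assoc₁ = solve-∀
    assoc₂ : ∀ d N h → d * d * (2 * N * h) ≡ 2 * N * d * (d * h)
    assoc₂ = solve-∀
    assoc₃ : ∀ d N h → 2 * N * d * (N * h) ≡ 2 * N * N * (d * h)
    assoc₃ = solve-∀

  -- The count of handcuffs has coefficients (k + 1)²; the rising product (k + 1)(k + 2) dominates
  -- them and telescopes exactly.
  squares≤h₃ : ∀ L → ∑ (downFrom (suc L)) (λ k → suc k * suc k * n ^ k * N ^ (L ∸ k)) ℕ.≤ h₃ L
  squares≤h₃ zero    = s≤s z≤n
  squares≤h₃ (suc L) = begin
    (2 + L) * (2 + L) * n ^ suc L * N ^ (suc L ∸ suc L) + ∑ (downFrom (suc L)) (λ k → c k * N ^ (suc L ∸ k))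
      ≡⟨ cong₂ _+_ (cong (λ e → c (suc L) * N ^ e) (ℕP.n∸n≡0 (suc L))) (∑-cong (downFrom (suc L)) λ k k∈ → shift k (ℕP.≤-pred (∈-downFrom⁻ k∈))) ⟩
    c (suc L) * 1 + ∑ (downFrom (suc L)) (λ k → N * (c k * N ^ (L ∸ k)))
      ≡⟨ cong₂ _+_ (ℕP.*-identityʳ _) (∑-*ˡ N _ (downFrom (suc L))) ⟩
    c (suc L) + N * ∑ (downFrom (suc L)) (λ k → c k * N ^ (L ∸ k))
      ≤⟨ ℕP.+-mono-≤ (ℕP.*-monoˡ-≤ (n ^ suc L) (ℕP.*-monoʳ-≤ (2 + L) (ℕP.n≤1+n (2 + L))))
                     (ℕP.*-monoʳ-≤ N (squares≤h₃ L)) ⟩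
    (2 + L) * (3 + L) * n ^ suc L + N * h₃ L
      ≡⟨ ℕP.+-comm _ (N * h₃ L) ⟩
    h₃ (suc L) ∎
    where
    open ℕP.≤-Reasoning
    c : ℕ → ℕ
    c k = suc k * suc k * n ^ k
    exchange : ∀ a b c → a * (b * c) ≡ b * (a * c)
    exchange = solve-∀
    shift : ∀ k → k ℕ.≤ L → c k * N ^ (suc L ∸ k) ≡ N * (c k * N ^ (L ∸ k))
    shift k k≤L = trans (cong (λ e → c k * N ^ e) (ℕP.+-∸-assoc 1 k≤L)) (exchange (c k) N _)

∑-concatMap : ∀ {A B : Set} (f : B → ℕ) (g : A → List B) xs →
              ∑ (concatMap g xs) f ≡ ∑ xs (λ x → ∑ (g x) f)
∑-concatMap f g []       = refl
∑-concatMap f g (x ∷ xs) = trans (∑-++ f (g x) _) (cong (∑ (g x) f +_) (∑-concatMap f g xs))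

∑-filter-≤ : ∀ {A : Set} {P : A → Set} (P? : ∀ x → Dec (P x)) (f : A → ℕ) xs →
             ∑ (filter P? xs) f ℕ.≤ ∑ xs f
∑-filter-≤ P? f []       = z≤n
∑-filter-≤ P? f (x ∷ xs) with P? x
... | yes _ = ℕP.+-monoʳ-≤ (f x) (∑-filter-≤ P? f xs)
... | no  _ = ℕP.≤-trans (∑-filter-≤ P? f xs) (ℕP.m≤n+m _ (f x))

module HandcuffFamily (n : ℕ) where

  words : ℕ → List (List (Fin n))
  words zero    = [] ∷ []
  words (suc k) = concatMap (λ x → map (x ∷_) (words k)) (allFin n)

  words-complete : ∀ xs → xs ∈ words (length xs)
  words-complete []       = here refl
  words-complete (x ∷ xs) = ∈-concatMap⁺ _ (lose (∈-allFin x) (∈-map⁺ (x ∷_) (words-complete xs)))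

  words-length : ∀ k {xs} → xs ∈ words k → length xs ≡ k
  words-length zero    (here refl) = refl
  words-length (suc k) xs∈ with find (∈-concatMap⁻ (λ x → map (x ∷_) (words k)) {xs = allFin n} xs∈)
  ... | x , _ , xs∈′ with ∈-map⁻ (x ∷_) xs∈′
  ... | ys , ys∈ , refl = cong suc (words-length k ys∈)

  ∑-words : ∀ k c → ∑ (words k) (λ _ → c) ≡ n ^ k * c
  ∑-words zero    c = refl
  ∑-words (suc k) c = begin
    ∑ (words (suc k)) (λ _ → c)                                ≡⟨ ∑-concatMap _ (λ x → map (x ∷_) (words k)) (allFin n) ⟩
    ∑ (allFin n) (λ x → ∑ (map (x ∷_) (words k)) (λ _ → c))    ≡⟨ ∑-cong (allFin n) (λ x _ → trans (∑-map _ (x ∷_) (words k)) (∑-words k c)) ⟩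
    ∑ (allFin n) (λ _ → n ^ k * c)                             ≡⟨ ∑-const _ (allFin n) ⟩
    length (allFin n) * (n ^ k * c)                            ≡⟨ cong (_* (n ^ k * c)) (ListP.length-tabulate {n = n} (λ i → i)) ⟩
    n * (n ^ k * c)                                            ≡⟨ ℕP.*-assoc n (n ^ k) c ⟨
    n * n ^ k * c                                              ∎
    where open ≡-Reasoning

  onPath : Fin n → List (Fin n) → List (List (Edge n))
  onPath x xs = concatMap (λ u → map (handcuff x xs u) (x ∷ xs)) (x ∷ xs)

  onPathsOfLength : ℕ → List (List (Edge n))
  onPathsOfLength k = concatMap (λ x → concatMap (onPath x) (words k)) (allFin n)

  -- Vertex sequences may repeat vertices, since only an upper bound on the count matters; the
  -- filter secures distinct edges, on which the fairness estimate rests. `k` counts the vertices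
  -- after the first, hence k < n.
  handcuffs : List (List (Edge n))
  handcuffs = filter (unique? _≟E_) (concatMap onPathsOfLength (downFrom n))

  handcuffs-unique : ∀ σ → σ ∈ handcuffs → Unique σ
  handcuffs-unique σ σ∈ = proj₂ (∈-filter⁻ (unique? _≟E_) {xs = concatMap onPathsOfLength (downFrom n)} σ∈)

  length-pathEdges : ∀ (x : Fin n) xs → length (pathEdges (x ∷ xs)) ≡ length xs
  length-pathEdges x []       = refl
  length-pathEdges x (y ∷ ys) = cong suc (length-pathEdges y ys)

  length-onPathsOfLength : ∀ k {σ} → σ ∈ onPathsOfLength k → length σ ≡ 2 + k
  length-onPathsOfLength k σ∈
    with find (∈-concatMap⁻ (λ x → concatMap (onPath x) (words k)) {xs = allFin n} σ∈)
  ... | x , _ , σ∈x with find (∈-concatMap⁻ (onPath x) {xs = words k} σ∈x)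
  ... | xs , xs∈ , σ∈xs with find (∈-concatMap⁻ (λ u → map (handcuff x xs u) (x ∷ xs)) {xs = x ∷ xs} σ∈xs)
  ... | u , _ , σ∈u with ∈-map⁻ (handcuff x xs u) σ∈u
  ... | v , _ , refl = cong (2 +_) (trans (length-pathEdges x xs) (words-length k xs∈))

  handcuffs-bounded : ∀ σ → σ ∈ handcuffs → length σ ℕ.≤ suc n
  handcuffs-bounded σ σ∈
    with find (∈-concatMap⁻ onPathsOfLength {xs = downFrom n} (proj₁ (∈-filter⁻ (unique? _≟E_) {xs = concatMap onPathsOfLength (downFrom n)} σ∈)))
  ... | k , k∈ , σ∈k = ℕP.≤-trans (ℕP.≤-reflexive (length-onPathsOfLength k σ∈k)) (s≤s (∈-downFrom⁻ k∈))

  handcuffs-complete : ∀ x xs u v → Unique (x ∷ xs) → u ∈ x ∷ xs → v ∈ x ∷ xs →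
                       Unique (handcuff x xs u v) → handcuff x xs u v ∈ handcuffs
  handcuffs-complete x xs u v uniq u∈ v∈ distinct = ∈-filter⁺ (unique? _≟E_)
    (∈-concatMap⁺ _ (lose (∈-downFrom⁺ short)
      (∈-concatMap⁺ _ (lose (∈-allFin x)
        (∈-concatMap⁺ _ (lose (words-complete xs)
          (∈-concatMap⁺ (λ u → map (handcuff x xs u) (x ∷ xs)) (lose u∈ (∈-map⁺ (handcuff x xs u) v∈))))))))) distinct
    where
    short : length xs ℕ.< n
    short = ℕP.≤-trans (unique-⊆⇒length≤ {ys = allFin n} uniq (λ y _ → ∈-allFin y))
                       (ℕP.≤-reflexive (ListP.length-tabulate (λ i → i)))

  ∑-onPathsOfLength : ∀ k (f : ℕ → ℕ) →
    ∑ (onPathsOfLength k) (λ σ → f (length σ)) ≡ n * (n ^ k * (suc k * (suc k * f (2 + k))))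
  ∑-onPathsOfLength k f = begin
    ∑ (onPathsOfLength k) (λ σ → f (length σ))
      ≡⟨ ∑-cong (onPathsOfLength k) (λ σ σ∈ → cong f (length-onPathsOfLength k σ∈)) ⟩
    ∑ (onPathsOfLength k) (λ _ → c)
      ≡⟨ ∑-concatMap _ (λ x → concatMap (onPath x) (words k)) (allFin n) ⟩
    ∑ (allFin n) (λ x → ∑ (concatMap (onPath x) (words k)) (λ _ → c))
      ≡⟨ ∑-cong (allFin n) (λ x _ → trans (∑-concatMap _ (onPath x) (words k)) (∑-cong (words k) (inner x))) ⟩
    ∑ (allFin n) (λ x → ∑ (words k) (λ _ → suc k * (suc k * c)))
      ≡⟨ ∑-cong (allFin n) (λ x _ → ∑-words k _) ⟩
    ∑ (allFin n) (λ x → n ^ k * (suc k * (suc k * c)))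
      ≡⟨ ∑-const _ (allFin n) ⟩
    length (allFin n) * (n ^ k * (suc k * (suc k * c)))
      ≡⟨ cong (_* (n ^ k * (suc k * (suc k * c)))) (ListP.length-tabulate {n = n} (λ i → i)) ⟩
    n * (n ^ k * (suc k * (suc k * c))) ∎
    where
    open ≡-Reasoning
    c : ℕ
    c = f (2 + k)
    inner : ∀ x xs → xs ∈ words k → ∑ (onPath x xs) (λ _ → c) ≡ suc k * (suc k * c)
    inner x xs xs∈ = begin
      ∑ (onPath x xs) (λ _ → c)
        ≡⟨ ∑-concatMap _ (λ u → map (handcuff x xs u) (x ∷ xs)) (x ∷ xs) ⟩
      ∑ (x ∷ xs) (λ u → ∑ (map (handcuff x xs u) (x ∷ xs)) (λ _ → c))
        ≡⟨ ∑-cong (x ∷ xs) (λ u _ → trans (∑-map _ (handcuff x xs u) (x ∷ xs)) (∑-const c (x ∷ xs))) ⟩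
      ∑ (x ∷ xs) (λ u → suc (length xs) * c)
        ≡⟨ ∑-const _ (x ∷ xs) ⟩
      suc (length xs) * (suc (length xs) * c)
        ≡⟨ cong (λ l → suc l * (suc l * c)) (words-length k xs∈) ⟩
      suc k * (suc k * c) ∎

-- There are n · n^k sequences of k + 1 vertices and (k + 1)² pairs of ends, and the exponent left
-- is n + 1 - (k + 2). The sum is therefore at most n · h₃(n - 1), to which `h₃-bound` applies.
handcuffs-light : ∀ n d → 2 * (n + d) * (n + d) ℕ.< d * d * d →
  ∑ (HandcuffFamily.handcuffs n) (λ σ → (n + d) ^ (suc n ∸ length σ)) ℕ.< (n + d) ^ suc n
handcuffs-light zero d@(suc _) small = s≤s z≤n
handcuffs-light n@(suc L) d small = ℕP.≰⇒> λ heavy → ℕP.<⇒≱ small (ℕP.*-cancelʳ-≤ _ _ (N ^ suc n) {{ℕP.m^n≢0 N (suc n)}} (begin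
    d * d * d * N ^ suc n        ≤⟨ ℕP.*-monoʳ-≤ (d * d * d) (ℕP.≤-trans heavy total) ⟩
    d * d * d * (n * h₃ L)       ≡⟨ exchange (d * d * d) n (h₃ L) ⟩
    n * (d * d * d * h₃ L)       ≤⟨ ℕP.*-mono-≤ (ℕP.m≤m+n n d) (h₃-bound L) ⟩
    N * (2 * N * N * N ^ suc L)  ≡⟨ exchange N (2 * N * N) _ ⟩
    2 * N * N * N ^ suc n        ∎))
  where
  open ℕP.≤-Reasoning
  open WeightedGeometricSums n d
  open HandcuffFamily n
  exchange : ∀ a b c → a * (b * c) ≡ b * (a * c)
  exchange = solve-∀
  regroup : ∀ n p s r → n * (p * (s * (s * r))) ≡ n * (s * s * p * r)
  regroup = solve-∀
  total : ∑ handcuffs (λ σ → N ^ (suc n ∸ length σ)) ℕ.≤ n * h₃ L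
  total = begin
    ∑ handcuffs (λ σ → N ^ (suc n ∸ length σ))
      ≤⟨ ∑-filter-≤ (unique? _≟E_) _ (concatMap onPathsOfLength (downFrom n)) ⟩
    ∑ (concatMap onPathsOfLength (downFrom n)) (λ σ → N ^ (suc n ∸ length σ))
      ≡⟨ ∑-concatMap _ onPathsOfLength (downFrom n) ⟩
    ∑ (downFrom n) (λ k → ∑ (onPathsOfLength k) (λ σ → N ^ (suc n ∸ length σ)))
      ≡⟨ ∑-cong (downFrom n) (λ k _ → trans (∑-onPathsOfLength k (λ l → N ^ (suc n ∸ l))) (regroup n (n ^ k) (suc k) _)) ⟩
    ∑ (downFrom n) (λ k → n * (suc k * suc k * n ^ k * N ^ (L ∸ k)))
      ≡⟨ ∑-*ˡ n _ (downFrom n) ⟩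
    n * ∑ (downFrom n) (λ k → suc k * suc k * n ^ k * N ^ (L ∸ k))
      ≤⟨ ℕP.*-monoʳ-≤ n (squares≤h₃ L) ⟩
    n * h₃ L ∎

client-keeps-K₄-minor-free : ∀ n q d → suc q ≡ n + d → 2 * (n + d) * (n + d) ℕ.< d * d * d →
  ClientWins {n} q (λ C → ¬ HasMinor 4 C) (allEdges n) []
client-keeps-K₄-minor-free n q d q+1≡n+d small = ClientWins-map minor-free
  (client-avoids (suc n) handcuffs handcuffs-unique handcuffs-bounded
    (subst (λ N → ∑ handcuffs (λ σ → N ^ (suc n ∸ length σ)) ℕ.< N ^ suc n) (sym q+1≡n+d) (handcuffs-light n d small)))
  where
  open HandcuffFamily n
  open Potential {n} q
  minor-free : ∀ C → ClientSafe (suc n) handcuffs handcuffs-unique handcuffs-bounded C → ¬ HasMinor 4 C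
  minor-free C (C⊆ , avoids) minor =
    let x , xs , u , v , uniq , u∈ , v∈ , distinct , within = FindHandcuff.K₄-minor⇒handcuff C C⊆ minor
    in avoids _ (handcuffs-complete x xs u v uniq u∈ v∈ distinct) within

-- Waiter builds a path

∈-take : ∀ {A : Set} k {xs : List A} {x} → x ∈ take k xs → x ∈ xs
∈-take (suc k) {y ∷ xs} (here eq)  = here eq
∈-take (suc k) {y ∷ xs} (there x∈) = there (∈-take k x∈)

offer-from : ∀ {n q} {F : List (Edge n)} G → Unique G → suc q ℕ.≤ length G →
             (∀ e → e ∈ G → e ∈ F) → Offer q F (take (suc q) G)
offer-from {q = q} G uG long G⊆F =
  trans (ListP.length-take (suc q) G) (ℕP.m≤n⇒m⊓n≡m long) , take⁺ (suc q) uG , λ e → G⊆F e ∘ ∈-take (suc q)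

unique-∖ : ∀ {n} {F S : List (Edge n)} → Unique F → Unique (F ∖ S)
unique-∖ = unique-filter⁺ _

unique-allEdges : ∀ n → Unique (allEdges n)
unique-allEdges n = unique-filter⁺ _ (cartesianProduct⁺ (allFin⁺ n) (allFin⁺ n))

-- Once a property that survives new edges holds, any offers will do until the board is exhausted.
play-out : ∀ {n q} {P : List (Edge n) → Set} → (∀ e C → P C → P (e ∷ C)) →
           ∀ k {F C} → length F ℕ.≤ k → Unique F → P C → WaiterWins q P F C
play-out {q = q} mono k {F} F≤k uF p with length F ℕ.≤? q
... | yes F≤q = endW F≤q p
... | no  F≰q = next k F≤k
  where
  offer = offer-from F uF (ℕP.≰⇒> F≰q) (λ _ e∈ → e∈)
  next : ∀ k → length F ℕ.≤ k → _
  next zero    F≤0 = ⊥-elim (F≰q (ℕP.≤-trans F≤0 z≤n))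
  next (suc k) F≤k = roundW (take (suc q) F) offer λ e e∈ →
    play-out mono k (ℕP.≤-pred (ℕP.≤-trans (length-∖-< (∈-take (suc q) e∈) e∈) F≤k)) (unique-∖ uF) (mono e _ p)

Adj-∷ : ∀ {n} {C : List (Edge n)} {e u v} → Adj C u v → Adj (e ∷ C) u v
Adj-∷ (inj₁ uv) = inj₁ (there uv)
Adj-∷ (inj₂ vu) = inj₂ (there vu)

Walk-∷ : ∀ {n} {C : List (Edge n)} {Q e u v} → Walk C Q u v → Walk (e ∷ C) Q u v
Walk-∷ here             = here
Walk-∷ (step uw Qw wv) = step (Adj-∷ uw) Qw (Walk-∷ wv)

HasMinor-∷ : ∀ {n t} e (C : List (Edge n)) → HasMinor t C → HasMinor t (e ∷ C)
HasMinor-∷ e C (branch , nonempty , connected , linked) =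
  branch , nonempty , (λ i u v Bu Bv → Walk-∷ (connected i u v Bu Bv)) ,
  λ i j i<j → let u , v , Bu , Bv , uv = linked i j i<j in u , v , Bu , Bv , Adj-∷ uv

residue-class-size : ∀ n r .{{_ : NonZero r}} c →
  length (filter (λ (w : Fin n) → toℕ w % r ℕ.≟ c) (allFin n)) ℕ.≤ suc (n / r)
residue-class-size n r c = begin
  length ws                                             ≡⟨ ListP.length-map toℕ ws ⟨
  length (map toℕ ws)                                   ≤⟨ unique-⊆⇒length≤ (map⁺ FinP.toℕ-injective (unique-filter⁺ _ (allFin⁺ n))) sub ⟩
  length (map (λ k → c + k * r) (upTo (suc (n / r))))   ≡⟨ ListP.length-map _ (upTo (suc (n / r))) ⟩
  length (upTo (suc (n / r)))                           ≡⟨ ListP.length-upTo _ ⟩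
  suc (n / r)                                           ∎
  where
  open ℕP.≤-Reasoning
  P? = λ (w : Fin n) → toℕ w % r ℕ.≟ c
  ws = filter P? (allFin n)
  sub : ∀ m → m ∈ map toℕ ws → m ∈ map (λ k → c + k * r) (upTo (suc (n / r)))
  sub m m∈ with ∈-map⁻ toℕ m∈
  ... | w , w∈ , refl = subst (_∈ map (λ k → c + k * r) (upTo (suc (n / r))))
    (sym (trans (m≡m%n+[m/n]*n (toℕ w) r) (cong (_+ toℕ w / r * r) (proj₂ (∈-filter⁻ P? {xs = allFin n} w∈)))))
    (∈-map⁺ (λ k → c + k * r) (∈-upTo⁺ (s≤s (/-monoˡ-≤ r (ℕP.<⇒≤ (FinP.toℕ<n w))))))

module PathStage (n q r : ℕ) .{{_ : NonZero r}} where

  open DecMembership (FinP._≟_ {n}) using (_∈?_)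

  -- Once v j has been extended, only the edges from v j to the residue class of j modulo r
  -- are guaranteed to be free; edges avoiding v 0, …, v (i − 1) have never been offered.
  record PathState (F C : List (Edge n)) (i : ℕ) (v : ℕ → Fin n) : Set where
    field
      distinct : ∀ {j k} → j ℕ.≤ i → k ℕ.≤ i → v j ≡ v k → j ≡ k
      linked   : ∀ {j} → j ℕ.< i → Adj C (v j) (v (suc j))
      -- Edges back to v 0, ..., v j are left out because they may have been offered at their other
      -- end. The class is that of the path index `j`, not that of the vertex v j.
      kept     : ∀ {j w} → j ℕ.< i → (∀ k → k ℕ.≤ j → v k ≢ w) → toℕ w % r ≡ j % r → mkEdge (v j) w ∈ F
      fresh    : ∀ {a b} → a ≢ b → (∀ k → k ℕ.< i → v k ≢ a) → (∀ k → k ℕ.< i → v k ≢ b) → mkEdge a b ∈ F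

  open PathState

  start-path : ∀ x → PathState (allEdges n) [] 0 (λ _ → x)
  start-path x = record
    { distinct = λ { z≤n z≤n _ → refl }
    ; linked   = λ ()
    ; kept     = λ ()
    ; fresh    = λ a≢b _ _ → mkEdge∈allEdges a≢b }

  module Extension {F C i v} (path : PathState F C i v) (room : suc q + suc i + suc (n / r) ℕ.≤ n) where

    visited : List (Fin n)
    visited = applyUpTo v (suc i)

    visited⁺ : ∀ {k} → k ℕ.≤ i → v k ∈ visited
    visited⁺ k≤i = ∈-applyUpTo⁺ v (s≤s k≤i)

    candidate? : ∀ w → Dec (w ∉ visited × toℕ w % r ≢ i % r)
    candidate? w = ¬? (w ∈? visited) ×-dec ¬? (toℕ w % r ℕ.≟ i % r)

    candidates : List (Fin n)
    candidates = filter candidate? (allFin n)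

    bundle : List (Edge n)
    bundle = map (mkEdge (v i)) candidates

    bundle⁻ : ∀ {e} → e ∈ bundle → ∃[ w ] (e ≡ mkEdge (v i) w × w ∉ visited × toℕ w % r ≢ i % r)
    bundle⁻ e∈ with ∈-map⁻ (mkEdge (v i)) e∈
    ... | w , w∈ , eq = w , eq , proj₂ (∈-filter⁻ candidate? {xs = allFin n} w∈)

    bundle-unique : Unique bundle
    bundle-unique = map⁺ injective (unique-filter⁺ _ (allFin⁺ n))
      where
      injective : ∀ {x y} → mkEdge (v i) x ≡ mkEdge (v i) y → x ≡ y
      injective eq with mkEdge-injective eq
      ... | inj₁ (_ , x≡y)     = x≡y
      ... | inj₂ (vi≡y , x≡vi) = trans x≡vi vi≡y

    -- At most i + 1 vertices are visited and at most n / r + 1 lie in the withheld class; these are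
    -- the summands of `room`.
    bundle-long : suc q ℕ.≤ length bundle
    bundle-long = ℕP.+-cancelʳ-≤ (suc i + suc (n / r)) _ _ (begin
      suc q + (suc i + suc (n / r))  ≡⟨ ℕP.+-assoc (suc q) (suc i) _ ⟨
      suc q + suc i + suc (n / r)    ≤⟨ room ⟩
      n                              ≡⟨ ListP.length-tabulate (λ k → k) ⟨
      length (allFin n)              ≤⟨ unique-⊆⇒length≤ (allFin⁺ n) cover ⟩
      length (candidates ++ visited ++ class)
        ≡⟨ trans (ListP.length-++ candidates) (cong (length candidates +_) (ListP.length-++ visited)) ⟩
      length candidates + (length visited + length class)
        ≤⟨ ℕP.+-mono-≤ (ℕP.≤-reflexive (sym (ListP.length-map (mkEdge (v i)) candidates)))
             (ℕP.+-mono-≤ (ℕP.≤-reflexive (ListP.length-applyUpTo v (suc i))) (residue-class-size n r (i % r))) ⟩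
      length bundle + (suc i + suc (n / r)) ∎)
      where
      open ℕP.≤-Reasoning
      class : List (Fin n)
      class = filter (λ w → toℕ w % r ℕ.≟ i % r) (allFin n)
      cover : ∀ w → w ∈ allFin n → w ∈ candidates ++ visited ++ class
      cover w w∈ with w ∈? visited | toℕ w % r ℕ.≟ i % r
      ... | yes w∈v | _         = ∈-++⁺ʳ candidates (∈-++⁺ˡ w∈v)
      ... | no  _   | yes w≡    = ∈-++⁺ʳ candidates (∈-++⁺ʳ visited (∈-filter⁺ _ w∈ w≡))
      ... | no  w∉v | no  w≢    = ∈-++⁺ˡ (∈-filter⁺ candidate? w∈ (w∉v , w≢))

    bundle-free : ∀ e → e ∈ bundle → e ∈ F
    bundle-free e e∈ with bundle⁻ e∈
    ... | w , refl , w∉ , _ = fresh path (λ { refl → w∉ (visited⁺ ℕP.≤-refl) })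
      (λ k k<i vk≡vi → ℕP.<⇒≢ k<i (distinct path (ℕP.<⇒≤ k<i) ℕP.≤-refl vk≡vi))
      (λ { k k<i refl → w∉ (visited⁺ (ℕP.<⇒≤ k<i)) })

    -- As paths are total functions on ℕ, all indices beyond `i` get the value `w`; the invariant
    -- after the step never looks past i + 1.
    extended : ∀ w → ℕ → Fin n
    extended w k with k ℕ.≤? i
    ... | yes _ = v k
    ... | no  _ = w

    extended-old : ∀ {w k} → k ℕ.≤ i → extended w k ≡ v k
    extended-old {w} {k} k≤i with k ℕ.≤? i
    ... | yes _   = refl
    ... | no  k≰i = ⊥-elim (k≰i k≤i)

    extended-new : ∀ {w} → extended w (suc i) ≡ w
    extended-new with suc i ℕ.≤? i
    ... | yes i<i = ⊥-elim (ℕP.<-irrefl refl i<i)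
    ... | no  _   = refl

    extend : ∀ {S w} → w ∉ visited → (∀ e → e ∈ S → e ∈ bundle) →
             PathState (F ∖ S) (mkEdge (v i) w ∷ C) (suc i) (extended w)
    extend {S} {w} w∉ S⊆ = record
      { distinct = distinct′ ; linked = linked′ ; kept = kept′ ; fresh = fresh′ }
      where
      v′ : ℕ → Fin n
      v′ = extended w
      distinct′ : ∀ {j k} → j ℕ.≤ suc i → k ℕ.≤ suc i → v′ j ≡ v′ k → j ≡ k
      distinct′ {j} {k} j≤ k≤ eq with ℕP.m≤n⇒m<n∨m≡n j≤ | ℕP.m≤n⇒m<n∨m≡n k≤
      ... | inj₁ (s≤s j≤i) | inj₁ (s≤s k≤i) =
        distinct path j≤i k≤i (trans (sym (extended-old j≤i)) (trans eq (extended-old k≤i)))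
      ... | inj₁ (s≤s j≤i) | inj₂ refl = ⊥-elim (w∉ (subst (_∈ visited)
        (trans (sym (extended-old j≤i)) (trans eq extended-new)) (visited⁺ j≤i)))
      ... | inj₂ refl | inj₁ (s≤s k≤i) = ⊥-elim (w∉ (subst (_∈ visited)
        (trans (sym (extended-old k≤i)) (trans (sym eq) extended-new)) (visited⁺ k≤i)))
      ... | inj₂ refl | inj₂ refl = refl
      linked′ : ∀ {j} → j ℕ.< suc i → Adj (mkEdge (v i) w ∷ C) (v′ j) (v′ (suc j))
      linked′ {j} (s≤s j≤i) with ℕP.m≤n⇒m<n∨m≡n j≤i
      ... | inj₁ j<i rewrite extended-old {w} j≤i | extended-old {w} j<i = Adj-∷ (linked path j<i)
      ... | inj₂ refl rewrite extended-old {w} j≤i | extended-new {w} = mkEdge∈⇒Adj (here refl)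
      kept′ : ∀ {j u} → j ℕ.< suc i → (∀ k → k ℕ.≤ j → v′ k ≢ u) → toℕ u % r ≡ j % r →
              mkEdge (v′ j) u ∈ F ∖ S
      kept′ {j} {u} (s≤s j≤i) off u≡j rewrite extended-old {w} j≤i with ℕP.m≤n⇒m<n∨m≡n j≤i
      ... | inj₁ j<i = ∈-∖⁺ (kept path j<i (λ k k≤j → subst (_≢ u) (extended-old (ℕP.≤-trans k≤j j≤i)) (off k k≤j)) u≡j) unoffered
        where
        unoffered : mkEdge (v j) u ∉ S
        unoffered e∈ with bundle⁻ (S⊆ _ e∈)
        ... | c , eq , c∉ , _ with mkEdge-injective eq
        ... | inj₁ (vj≡vi , _) = ℕP.<⇒≢ j<i (distinct path j≤i ℕP.≤-refl vj≡vi)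
        ... | inj₂ (refl , _)  = c∉ (visited⁺ j≤i)
      -- At the vertex just extended, the edge was untouched before this round, and this offer
      -- avoids the class of `i`.
      ... | inj₂ refl = ∈-∖⁺ (fresh path (off′ i ℕP.≤-refl)
          (λ k k<i vk≡vi → ℕP.<⇒≢ k<i (distinct path (ℕP.<⇒≤ k<i) ℕP.≤-refl vk≡vi))
          (λ k k<i → off′ k (ℕP.<⇒≤ k<i))) unoffered
        where
        off′ : ∀ k → k ℕ.≤ i → v k ≢ u
        off′ k k≤i = subst (_≢ u) (extended-old k≤i) (off k k≤i)
        unoffered : mkEdge (v i) u ∉ S
        unoffered e∈ with bundle⁻ (S⊆ _ e∈)
        ... | c , eq , c∉ , c≢ with mkEdge-injective eq
        ... | inj₁ (_ , refl) = c≢ u≡j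
        ... | inj₂ (refl , _) = c∉ (visited⁺ ℕP.≤-refl)
      fresh′ : ∀ {a b} → a ≢ b → (∀ k → k ℕ.< suc i → v′ k ≢ a) → (∀ k → k ℕ.< suc i → v′ k ≢ b) →
               mkEdge a b ∈ F ∖ S
      fresh′ {a} {b} a≢b a∉ b∉ = ∈-∖⁺ (fresh path a≢b (λ k k<i → old a∉ k (ℕP.<⇒≤ k<i)) (λ k k<i → old b∉ k (ℕP.<⇒≤ k<i))) unoffered
        where
        old : ∀ {a} → (∀ k → k ℕ.< suc i → v′ k ≢ a) → ∀ k → k ℕ.≤ i → v k ≢ a
        old {a} a∉ k k≤i = subst (_≢ a) (extended-old k≤i) (a∉ k (s≤s k≤i))
        unoffered : mkEdge a b ∉ S
        unoffered e∈ with bundle⁻ (S⊆ _ e∈)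
        ... | c , eq , _ with mkEdge-injective eq
        ... | inj₁ (a≡vi , _) = old a∉ i ℕP.≤-refl (sym a≡vi)
        ... | inj₂ (_ , b≡vi) = old b∉ i ℕP.≤-refl (sym b≡vi)

  -- The continuation is the rest of Waiter's strategy: different answers of Client lead to
  -- different paths, and play goes on from whichever path of length `ℓ` results.
  build-path : ∀ {P : List (Edge n) → Set} ℓ → suc q + ℓ + suc (n / r) ℕ.≤ n →
    (∀ {F C v} → Unique F → PathState F C ℓ v → WaiterWins q P F C) →
    ∀ k {F C i v} → i + k ≡ ℓ → Unique F → PathState F C i v → WaiterWins q P F C
  build-path ℓ room continue zero {i = i} i+0≡ℓ uF path
    rewrite trans (sym (ℕP.+-identityʳ i)) i+0≡ℓ = continue uF path
  build-path ℓ room continue (suc k) {F} {C} {i} {v} i+k≡ℓ uF path =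
    roundW (take (suc q) bundle) (offer-from bundle bundle-unique bundle-long bundle-free) respond
    where
    i<ℓ : suc i ℕ.≤ ℓ
    i<ℓ = subst (suc i ℕ.≤_) (trans (sym (ℕP.+-suc i k)) i+k≡ℓ) (ℕP.m≤m+n (suc i) k)
    open Extension path (ℕP.≤-trans (ℕP.+-monoˡ-≤ (suc (n / r)) (ℕP.+-monoʳ-≤ (suc q) i<ℓ)) room)
    respond : ∀ e → e ∈ take (suc q) bundle → WaiterWins q _ (F ∖ take (suc q) bundle) (e ∷ C)
    respond e e∈ with bundle⁻ (∈-take (suc q) e∈)
    ... | w , refl , w∉ , _ = build-path ℓ room continue k (trans (sym (ℕP.+-suc i k)) i+k≡ℓ) (unique-∖ uF)
                                (extend w∉ (λ _ → ∈-take (suc q)))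

-- Waiter links the segments

length-cartesianProduct : ∀ {A B : Set} (xs : List A) (ys : List B) →
                          length (cartesianProduct xs ys) ≡ length xs * length ys
length-cartesianProduct []       ys = refl
length-cartesianProduct (x ∷ xs) ys = trans (ListP.length-++ (map (x ,_) ys))
  (cong₂ _+_ (ListP.length-map (x ,_) ys) (length-cartesianProduct xs ys))

module LinkStage (n q r p t : ℕ) .{{_ : NonZero r}} where

  s : ℕ
  s = p * r

  InSegment : ℕ → ℕ → Set
  InSegment I a = I * s ℕ.≤ a × a ℕ.< suc I * s

  segment-unique : ∀ {I J a} → InSegment I a → InSegment J a → I ≡ J
  segment-unique {I} {J} (Is≤a , a<) (Js≤a , a<′) with ℕP.<-cmp I J
  ... | tri< I<J _ _ = ⊥-elim (ℕP.<⇒≱ a< (ℕP.≤-trans (ℕP.*-monoˡ-≤ s I<J) Js≤a))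
  ... | tri≈ _ I≡J _ = I≡J
  ... | tri> _ _ J<I = ⊥-elim (ℕP.<⇒≱ a<′ (ℕP.≤-trans (ℕP.*-monoˡ-≤ s J<I) Is≤a))

  segment-index : ∀ J (j : Fin s) → InSegment J (J * s + toℕ j)
  segment-index J j = ℕP.m≤m+n (J * s) _ ,
    ℕP.≤-trans (ℕP.+-monoʳ-< (J * s) (FinP.toℕ<n j)) (ℕP.≤-reflexive (ℕP.+-comm (J * s) s))

  -- A segment is `p` full blocks of `r` consecutive indices, each starting at a multiple of `r`, so
  -- it holds `p` indices of every residue.
  segment-residue : ∀ I (k : Fin p) {c} → c ℕ.< r → InSegment I (c + (I * p + toℕ k) * r)
  segment-residue I k {c} c<r = lower , upper
    where
    open ℕP.≤-Reasoning
    lower : I * s ℕ.≤ c + (I * p + toℕ k) * r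
    lower = begin
      I * (p * r)                ≡⟨ ℕP.*-assoc I p r ⟨
      I * p * r                  ≤⟨ ℕP.*-monoˡ-≤ r (ℕP.m≤m+n (I * p) (toℕ k)) ⟩
      (I * p + toℕ k) * r        ≤⟨ ℕP.m≤n+m _ c ⟩
      c + (I * p + toℕ k) * r    ∎
    upper : c + (I * p + toℕ k) * r ℕ.< suc I * s
    upper = begin-strict
      c + (I * p + toℕ k) * r    <⟨ ℕP.+-monoˡ-< _ c<r ⟩
      suc (I * p + toℕ k) * r    ≤⟨ ℕP.*-monoˡ-≤ r (ℕP.+-monoʳ-< (I * p) (FinP.toℕ<n k)) ⟩
      (I * p + p) * r            ≡⟨ cong (_* r) (ℕP.+-comm (I * p) p) ⟩
      suc I * p * r              ≡⟨ ℕP.*-assoc (suc I) p r ⟩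
      suc I * (p * r)            ∎

  module _ (ℓ : ℕ) (sucℓ : suc ℓ ≡ t * s) (v : ℕ → Fin n)
           (distinct : ∀ {j k} → j ℕ.≤ ℓ → k ℕ.≤ ℓ → v j ≡ v k → j ≡ k)
           (wide : suc q ℕ.≤ s * p) where

    segment-≤ : ∀ (I : Fin t) {a} → InSegment (toℕ I) a → a ℕ.≤ ℓ
    segment-≤ I (_ , a<) = ℕP.≤-pred (ℕP.≤-trans a<
      (ℕP.≤-trans (ℕP.*-monoˡ-≤ s (FinP.toℕ<n I)) (ℕP.≤-reflexive (sym sucℓ))))

    -- The source index has the same residue modulo `r` as the vertex at the target index, so `kept`
    -- makes the edge free. Each of the `s` targets has `p` such sources, which supplies the `s * p`
    -- edges for the linking round.
    target source : Fin t → Fin t → Fin s × Fin p → ℕ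
    target I J (j , k) = toℕ J * s + toℕ j
    source I J jk@(j , k) = toℕ (v (target I J jk)) % r + (toℕ I * p + toℕ k) * r

    target∈ : ∀ I J jk → InSegment (toℕ J) (target I J jk)
    target∈ I J (j , k) = segment-index (toℕ J) j

    source∈ : ∀ I J jk → InSegment (toℕ I) (source I J jk)
    source∈ I J (j , k) = segment-residue (toℕ I) k (m%n<n _ r)

    link : Fin t → Fin t → Fin s × Fin p → Edge n
    link I J jk = mkEdge (v (source I J jk)) (v (target I J jk))

    -- Distinct path vertices let both indices be read off the edge, up to order; the crossed order
    -- would give J = I′ < J′ = I. This yields injectivity within a bundle and disjointness of
    -- different bundles.
    link-ends : ∀ {I J I′ J′} x x′ → I Fin.< J → I′ Fin.< J′ → link I J x ≡ link I′ J′ x′ →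
                (I ≡ I′ × J ≡ J′) × source I J x ≡ source I′ J′ x′ × target I J x ≡ target I′ J′ x′
    link-ends {I} {J} {I′} {J′} x x′ I<J I′<J′ eq with mkEdge-injective eq
    ... | inj₁ (s≡ , t≡) = (FinP.toℕ-injective I≡I′ , FinP.toℕ-injective J≡J′) , src≡ , tgt≡
      where
      src≡ = distinct (segment-≤ I (source∈ I J x)) (segment-≤ I′ (source∈ I′ J′ x′)) s≡
      tgt≡ = distinct (segment-≤ J (target∈ I J x)) (segment-≤ J′ (target∈ I′ J′ x′)) t≡
      I≡I′ = segment-unique (source∈ I J x) (subst (InSegment (toℕ I′)) (sym src≡) (source∈ I′ J′ x′))
      J≡J′ = segment-unique (target∈ I J x) (subst (InSegment (toℕ J′)) (sym tgt≡) (target∈ I′ J′ x′))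
    ... | inj₂ (s≡ , t≡) = ⊥-elim (ℕP.<-asym I<J (subst₂ ℕ._<_ (sym J≡I′) (sym I≡J′) I′<J′))
      where
      src≡ = distinct (segment-≤ I (source∈ I J x)) (segment-≤ J′ (target∈ I′ J′ x′)) s≡
      tgt≡ = distinct (segment-≤ J (target∈ I J x)) (segment-≤ I′ (source∈ I′ J′ x′)) t≡
      I≡J′ = segment-unique (source∈ I J x) (subst (InSegment (toℕ J′)) (sym src≡) (target∈ I′ J′ x′))
      J≡I′ = segment-unique (target∈ I J x) (subst (InSegment (toℕ I′)) (sym tgt≡) (source∈ I′ J′ x′))

    link-injective : ∀ {I J} → I Fin.< J → ∀ {x x′} → link I J x ≡ link I J x′ → x ≡ x′
    link-injective {I} {J} I<J {j , k} {j′ , k′} eq with link-ends (j , k) (j′ , k′) I<J I<J eq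
    ... | _ , src≡ , tgt≡ with FinP.toℕ-injective (ℕP.+-cancelˡ-≡ (toℕ J * s) _ _ tgt≡)
    ... | refl = cong (j ,_) (FinP.toℕ-injective (ℕP.+-cancelˡ-≡ (toℕ I * p) _ _
                   (ℕP.*-cancelʳ-≡ _ _ r (ℕP.+-cancelˡ-≡ (toℕ (v (target I J (j , k))) % r) _ _ src≡))))

    bundle : Fin t → Fin t → List (Edge n)
    bundle I J = map (link I J) (cartesianProduct (allFin s) (allFin p))

    bundle-unique : ∀ {I J} → I Fin.< J → Unique (bundle I J)
    bundle-unique I<J = map⁺ (link-injective I<J) (cartesianProduct⁺ (allFin⁺ s) (allFin⁺ p))

    bundle-long : ∀ I J → suc q ℕ.≤ length (bundle I J)
    bundle-long I J = ℕP.≤-trans wide (ℕP.≤-reflexive (sym (begin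
      length (bundle I J)                                ≡⟨ ListP.length-map (link I J) (cartesianProduct (allFin s) (allFin p)) ⟩
      length (cartesianProduct (allFin s) (allFin p))    ≡⟨ length-cartesianProduct (allFin s) (allFin p) ⟩
      length (allFin s) * length (allFin p)
        ≡⟨ cong₂ _*_ (ListP.length-tabulate {n = s} (λ i → i)) (ListP.length-tabulate {n = p} (λ i → i)) ⟩
      s * p ∎)))
      where open ≡-Reasoning

    SegmentsLinked : List (Edge n) → Fin t → Fin t → Set
    SegmentsLinked C I J = ∃[ a ] ∃[ b ] (InSegment (toℕ I) a × InSegment (toℕ J) b × Adj C (v a) (v b))

    module _ {C : List (Edge n)} (path : ∀ {j} → j ℕ.< ℓ → Adj C (v j) (v (suc j)))
             (links : ∀ I J → I Fin.< J → SegmentsLinked C I J) where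

      OnSegment : Fin t → Fin n → Set
      OnSegment I u = ∃[ j ] (v (toℕ I * s + toℕ {s} j) ≡ u)

      onSegment? : ∀ u → Dec (∃[ I ] OnSegment I u)
      onSegment? u = FinP.any? λ I → FinP.any? λ j → v (toℕ I * s + toℕ j) FinP.≟ u

      branch : Fin n → Maybe (Fin t)
      branch u with onSegment? u
      ... | yes (I , _) = just I
      ... | no  _       = nothing

      branch⁺ : ∀ I {a} → InSegment (toℕ I) a → branch (v a) ≡ just I
      branch⁺ I {a} a∈ with onSegment? (v a)
      ... | yes (J , j , eq) = cong just (FinP.toℕ-injective (segment-unique
              (subst (InSegment (toℕ J)) (distinct (segment-≤ J (segment-index (toℕ J) j)) (segment-≤ I a∈) eq) (segment-index (toℕ J) j)) a∈))
      ... | no  none = ⊥-elim (none (I , Fin.fromℕ< offset< , cong v (trans (cong (toℕ I * s +_) (FinP.toℕ-fromℕ< offset<)) (ℕP.m+[n∸m]≡n (proj₁ a∈)))))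
        where
        offset< : a ∸ toℕ I * s ℕ.< s
        offset< = ℕP.+-cancelˡ-< (toℕ I * s) _ _ (subst₂ ℕ._<_ (sym (ℕP.m+[n∸m]≡n (proj₁ a∈))) (ℕP.+-comm s (toℕ I * s)) (proj₂ a∈))

      branch⁻ : ∀ {I u} → branch u ≡ just I → ∃[ a ] (InSegment (toℕ I) a × v a ≡ u)
      branch⁻ {I} {u} eq with onSegment? u
      branch⁻ refl | yes (I , j , vj≡u) = toℕ I * s + toℕ j , segment-index (toℕ I) j , vj≡u

      walk-up : ∀ I d {a} → InSegment (toℕ I) a → InSegment (toℕ I) (d + a) →
                Walk C (λ u → branch u ≡ just I) (v a) (v (d + a))
      walk-up I zero    a∈ _ = here
      walk-up I (suc d) {a} a∈ d+a∈ = step (path a<ℓ) (branch⁺ I a+1∈)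
          (subst (λ b → Walk C (λ u → branch u ≡ just I) (v (suc a)) (v b)) (ℕP.+-suc d a) (walk-up I d a+1∈ (subst (InSegment (toℕ I)) (sym (ℕP.+-suc d a)) d+a∈)))
        where
        a+1≤ : suc a ℕ.≤ suc d + a
        a+1≤ = s≤s (ℕP.m≤n+m a d)
        a+1∈ : InSegment (toℕ I) (suc a)
        a+1∈ = ℕP.≤-trans (proj₁ a∈) (ℕP.n≤1+n a) , ℕP.≤-<-trans a+1≤ (proj₂ d+a∈)
        a<ℓ : a ℕ.< ℓ
        a<ℓ = ℕP.≤-trans a+1≤ (segment-≤ I d+a∈)

      walk-down : ∀ I d {a} → InSegment (toℕ I) a → InSegment (toℕ I) (d + a) →
                  Walk C (λ u → branch u ≡ just I) (v (d + a)) (v a)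
      walk-down I zero    a∈ _ = here
      walk-down I (suc d) {a} a∈ d+a∈ = step (Adj-sym (path (segment-≤ I d+a∈))) (branch⁺ I below) (walk-down I d a∈ below)
        where
        below : InSegment (toℕ I) (d + a)
        below = ℕP.≤-trans (proj₁ a∈) (ℕP.m≤n+m a d) , ℕP.<-trans (ℕP.n<1+n _) (proj₂ d+a∈)

      linked-segments⇒minor : 1 ℕ.≤ s → HasMinor t C
      linked-segments⇒minor 1≤s = branch ,
        (λ I → v (toℕ I * s) , branch⁺ I (ℕP.≤-refl , ℕP.+-monoˡ-≤ (toℕ I * s) 1≤s)) ,
        connected ,
        λ I J I<J → let a , b , a∈ , b∈ , ab = links I J I<J in v a , v b , branch⁺ I a∈ , branch⁺ J b∈ , ab
        where
        connected : ∀ I u w → branch u ≡ just I → branch w ≡ just I → Walk C (λ x → branch x ≡ just I) u w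
        connected I u w Bu Bw with branch⁻ Bu | branch⁻ Bw
        ... | a , a∈ , refl | b , b∈ , refl with ℕP.≤-total a b
        ... | inj₁ a≤b = subst (λ c → Walk C _ (v a) (v c)) (ℕP.m∸n+n≡m a≤b)
                (walk-up I (b ∸ a) a∈ (subst (InSegment (toℕ I)) (sym (ℕP.m∸n+n≡m a≤b)) b∈))
        ... | inj₂ b≤a = subst (λ c → Walk C _ (v c) (v b)) (ℕP.m∸n+n≡m b≤a)
                (walk-down I (a ∸ b) b∈ (subst (InSegment (toℕ I)) (sym (ℕP.m∸n+n≡m b≤a)) a∈))

    -- Any answer of Client links the pair on offer. The bundles of different pairs are disjoint, so
    -- the round leaves the remaining bundles intact, and every pair is at all times pending or
    -- linked.
    link-segments : ∀ pairs {F C} → Unique pairs → (∀ {I J} → (I , J) ∈ pairs → I Fin.< J) → Unique F →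
      (∀ {j} → j ℕ.< ℓ → Adj C (v j) (v (suc j))) →
      (∀ {I J} → (I , J) ∈ pairs → ∀ e → e ∈ bundle I J → e ∈ F) →
      (∀ I J → I Fin.< J → (I , J) ∈ pairs ⊎ SegmentsLinked C I J) →
      WaiterWins q (HasMinor t) F C
    link-segments [] {F} {C} _ _ uF path _ links = play-out HasMinor-∷ _ ℕP.≤-refl uF
      (linked-segments⇒minor path linked (positive s wide))
      where
      linked : ∀ I J → I Fin.< J → SegmentsLinked C I J
      linked I J I<J with links I J I<J
      ... | inj₂ IJ = IJ
      -- A branch set must contain a vertex; `wide` forces the segments to be nonempty.
      positive : ∀ s → suc q ℕ.≤ s * p → 1 ℕ.≤ s
      positive (suc _) _ = s≤s z≤n
    link-segments ((I , J) ∷ pairs) {F} {C} (IJ∉ ∷ u) ordered uF path free links =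
      roundW S (offer-from (bundle I J) (bundle-unique I<J) (bundle-long I J) (free (here refl))) respond
      where
      I<J : I Fin.< J
      I<J = ordered (here refl)
      S : List (Edge n)
      S = take (suc q) (bundle I J)
      respond : ∀ e → e ∈ S → WaiterWins q (HasMinor t) (F ∖ S) (e ∷ C)
      respond e e∈ with ∈-map⁻ (link I J) (∈-take (suc q) e∈)
      ... | x , _ , refl = link-segments pairs u (ordered ∘ there) (unique-∖ uF) (Adj-∷ ∘ path) free′ links′
        where
        free′ : ∀ {I′ J′} → (I′ , J′) ∈ pairs → ∀ e → e ∈ bundle I′ J′ → e ∈ F ∖ S
        free′ {I′} {J′} pair∈ e e∈′ = ∈-∖⁺ (free (there pair∈) e e∈′) unoffered
          where
          unoffered : e ∉ S
          unoffered e∈S with ∈-map⁻ (link I J) (∈-take (suc q) e∈S) | ∈-map⁻ (link I′ J′) e∈′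
          ... | y , _ , refl | y′ , _ , eq with link-ends y y′ I<J (ordered (there pair∈)) eq
          ... | (refl , refl) , _ = All.lookup IJ∉ pair∈ refl
        links′ : ∀ I′ J′ → I′ Fin.< J′ → (I′ , J′) ∈ pairs ⊎ SegmentsLinked (link I J x ∷ C) I′ J′
        links′ I′ J′ I′<J′ with links I′ J′ I′<J′
        ... | inj₁ (here refl) = inj₂ (source I J x , target I J x , source∈ I J x , target∈ I J x , mkEdge∈⇒Adj (here refl))
        ... | inj₁ (there pair∈) = inj₁ pair∈
        ... | inj₂ (a , b , a∈ , b∈ , ab) = inj₂ (a , b , a∈ , b∈ , Adj-∷ ab)

waiter-forces-minor : ∀ n q r p t .{{_ : NonZero r}} ℓ → suc ℓ ≡ t * (p * r) →
  suc q ℕ.≤ p * r * p → suc q + suc ℓ + suc (n / r) ℕ.≤ n →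
  WaiterWins {n} q (HasMinor t) (allEdges n) []
waiter-forces-minor (suc n) q r p t ℓ sucℓ wide room =
  build-path ℓ (ℕP.≤-trans (ℕP.+-monoˡ-≤ _ (ℕP.+-monoʳ-≤ (suc q) (ℕP.n≤1+n ℓ))) room)
    link-up ℓ refl (unique-allEdges (suc n)) (start-path Fin.zero)
  where
  open PathStage (suc n) q r
  open LinkStage (suc n) q r p t
  link-up : ∀ {F C v} → Unique F → PathState F C ℓ v → WaiterWins q (HasMinor t) F C
  -- `allEdges t` doubles as the list of pairs of segments I < J.
  link-up {F} {C} {v} uF path = link-segments ℓ sucℓ v distinct wide (allEdges t) (unique-allEdges t)
      allEdges-ordered uF linked free (λ I J I<J → inj₁ (ordered∈allEdges I<J))
    where
    open PathState path
    free : ∀ {I J} → (I , J) ∈ allEdges t → ∀ e → e ∈ bundle ℓ sucℓ v distinct wide I J → e ∈ F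
    free {I} {J} IJ∈ e e∈ with ∈-map⁻ (link ℓ sucℓ v distinct wide I J) e∈
    -- The source index precedes the target index because I < J, so the edge points forward as
    -- `kept` demands.
    ... | x , _ , refl = kept (ℕP.<-≤-trans a<b b≤ℓ) before residue
      where
      a b : ℕ
      a = source ℓ sucℓ v distinct wide I J x
      b = target ℓ sucℓ v distinct wide I J x
      a<b : a ℕ.< b
      a<b = ℕP.<-≤-trans (proj₂ (source∈ ℓ sucℓ v distinct wide I J x))
              (ℕP.≤-trans (ℕP.*-monoˡ-≤ (p * r) (allEdges-ordered IJ∈)) (proj₁ (target∈ ℓ sucℓ v distinct wide I J x)))
      b≤ℓ : b ℕ.≤ ℓ
      b≤ℓ = segment-≤ ℓ sucℓ v distinct wide J (target∈ ℓ sucℓ v distinct wide I J x)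
      before : ∀ k → k ℕ.≤ a → v k ≢ v b
      before k k≤a vk≡vb = ℕP.<⇒≢ (ℕP.≤-<-trans k≤a a<b)
        (distinct (ℕP.≤-trans k≤a (ℕP.≤-trans (ℕP.<⇒≤ a<b) b≤ℓ)) b≤ℓ vk≡vb)
      residue : toℕ (v b) % r ≡ a % r
      residue = sym (trans ([m+kn]%n≡m%n (toℕ (v b) % r) (toℕ I * p + toℕ (proj₂ x)) r) (m%n%n≡m%n (toℕ (v b)) r))

-- Arithmetic

-- `k` is the integer part of √(m/2); its successor will serve as `p`.
square-root : ∀ m → ∃[ k ] (2 * (k * k) ℕ.≤ m × m ℕ.< 2 * (suc k * suc k))
square-root zero    = 0 , z≤n , s≤s z≤n
square-root (suc m) with square-root m
... | k , 2k²≤m , m< with suc m ℕ.<? 2 * (suc k * suc k)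
... | yes 1+m< = k , ℕP.m≤n⇒m≤1+n 2k²≤m , 1+m<
... | no  1+m≮ = suc k , ℕP.≮⇒≥ 1+m≮ ,
  ℕP.≤-<-trans m< (ℕP.*-monoʳ-< 2 (ℕP.*-mono-< (ℕP.n<1+n (suc k)) (ℕP.n<1+n (suc k))))

2ab≤a²+b² : ∀ a b → 2 * (a * b) ℕ.≤ a * a + b * b
2ab≤a²+b² a b with ℕP.≤-total a b
... | inj₁ a≤b = ordered a≤b
  where
  identity : ∀ a e → 2 * (a * (a + e)) + e * e ≡ a * a + (a + e) * (a + e)
  identity = solve-∀
  ordered : ∀ {a b} → a ℕ.≤ b → 2 * (a * b) ℕ.≤ a * a + b * b
  ordered {a} {b} a≤b = subst (λ c → 2 * (a * c) ℕ.≤ a * a + c * c) (ℕP.m+[n∸m]≡n a≤b)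
    (ℕP.≤-trans (ℕP.m≤m+n _ _) (ℕP.≤-reflexive (identity a (b ∸ a))))
... | inj₂ b≤a = subst (λ a → 2 * (a * b) ℕ.≤ a * a + b * b) (ℕP.m+[n∸m]≡n b≤a)
    (ℕP.≤-trans (ℕP.m≤m+n _ _) (ℕP.≤-reflexive (identity b (a ∸ b))))
  where
  identity : ∀ b e → 2 * ((b + e) * b) + e * e ≡ (b + e) * (b + e) + b * b
  identity = solve-∀

-- The hypotheses give m · m³ ≥ 256 m³. The bound is stated with 252 because `branch-budget`
-- consumes it through 9 · 84 = 3 · 252.
slack-≥252 : ∀ {n m} → 1 ℕ.≤ n → m ℕ.≤ n → 256 * (n * n * n) ℕ.≤ m * m * m * m → 252 ℕ.≤ m
slack-≥252 {suc n} {zero}  _ _   ()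
slack-≥252 {n} {m@(suc _)} _ m≤n large = ℕP.*-cancelʳ-≤ 252 m (m * m * m) (begin
  252 * (m * m * m)    ≤⟨ ℕP.*-mono-≤ {x = 252} {y = 256} (ℕP.m≤m+n 252 4) (ℕP.*-mono-≤ (ℕP.*-mono-≤ m≤n m≤n) m≤n) ⟩
  256 * (n * n * n)    ≤⟨ large ⟩
  m * m * m * m        ≡⟨ ℕP.*-comm (m * m * m) m ⟩
  m * (m * m * m)      ∎)
  where open ℕP.≤-Reasoning

-- `L` has to stay a little below m/2. The premises give 12p² ≤ 7m + 84 for p = k + 1, hence L² ≤
-- 0.22 m² and L ≤ 19m/40; the remaining m/20 pays for the 4, which collects the successors in
-- `room`.
branch-budget : ∀ {k m L} → 252 ℕ.≤ m → 2 * (k * k) ℕ.≤ m →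
                25 * (L * L) ℕ.≤ 9 * (suc k * suc k) * m → 2 * L + 4 ℕ.≤ m
branch-budget {k} {m@(suc _)} {L} 252≤m 2k²≤m budget = ℕP.*-cancelˡ-≤ 20 (begin
  20 * (2 * L + 4)     ≡⟨ twenty L ⟩
  40 * L + 80          ≤⟨ ℕP.+-mono-≤ 40L≤19m (ℕP.≤-trans (ℕP.m≤m+n 80 172) 252≤m) ⟩
  19 * m + m           ≡⟨ ℕP.+-comm (19 * m) m ⟩
  20 * m               ∎)
  where
  open ℕP.≤-Reasoning
  twenty : ∀ L → 20 * (2 * L + 4) ≡ 40 * L + 80
  twenty = solve-∀
  expand : ∀ k → 12 * (suc k * suc k) ≡ 6 * (2 * (k * k)) + 2 * (2 * (6 * k)) + 12
  expand = solve-∀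
  collect : ∀ k m → 6 * m + 2 * (6 * 6 + k * k) + 12 ≡ 6 * m + 2 * (k * k) + 84
  collect = solve-∀
  -- The cross term 24k is absorbed by 2 · 6 · k ≤ 36 + k², and the new k² terms raise 6m to 7m.
  12p²≤ : 12 * (suc k * suc k) ℕ.≤ 7 * m + 84
  12p²≤ = begin
    12 * (suc k * suc k)                              ≡⟨ expand k ⟩
    6 * (2 * (k * k)) + 2 * (2 * (6 * k)) + 12        ≤⟨ ℕP.+-monoˡ-≤ 12 (ℕP.+-mono-≤ (ℕP.*-monoʳ-≤ 6 2k²≤m) (ℕP.*-monoʳ-≤ 2 (2ab≤a²+b² 6 k))) ⟩
    6 * m + 2 * (6 * 6 + k * k) + 12                  ≡⟨ collect k m ⟩
    6 * m + 2 * (k * k) + 84                          ≤⟨ ℕP.+-monoˡ-≤ 84 (ℕP.+-monoʳ-≤ (6 * m) 2k²≤m) ⟩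
    6 * m + m + 84                                    ≡⟨ cong (_+ 84) (ℕP.+-comm (6 * m) m) ⟩
    7 * m + 84                                        ∎
  e₁ : ∀ l → 6 * (50 * l) ≡ 12 * (25 * l)
  e₁ = solve-∀
  e₂ : ∀ m p → 12 * (9 * p * m) ≡ 9 * m * (12 * p)
  e₂ = solve-∀
  e₃ : ∀ m → 9 * m * (7 * m + 84) ≡ 63 * (m * m) + 3 * (252 * m)
  e₃ = solve-∀
  e₄ : ∀ m → 63 * (m * m) + 3 * (m * m) ≡ 6 * (11 * (m * m))
  e₄ = solve-∀
  50L²≤ : 50 * (L * L) ℕ.≤ 11 * (m * m)
  50L²≤ = ℕP.*-cancelˡ-≤ 6 (begin
    6 * (50 * (L * L))                  ≡⟨ e₁ (L * L) ⟩
    12 * (25 * (L * L))                 ≤⟨ ℕP.*-monoʳ-≤ 12 budget ⟩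
    12 * (9 * (suc k * suc k) * m)      ≡⟨ e₂ m (suc k * suc k) ⟩
    9 * m * (12 * (suc k * suc k))      ≤⟨ ℕP.*-monoʳ-≤ (9 * m) 12p²≤ ⟩
    9 * m * (7 * m + 84)                ≡⟨ e₃ m ⟩
    63 * (m * m) + 3 * (252 * m)        ≤⟨ ℕP.+-monoʳ-≤ (63 * (m * m)) (ℕP.*-monoʳ-≤ 3 (ℕP.*-monoˡ-≤ m 252≤m)) ⟩
    63 * (m * m) + 3 * (m * m)          ≡⟨ e₄ m ⟩
    6 * (11 * (m * m))                  ∎)
  e₅ : ∀ L → (40 * L) * (40 * L) ≡ 32 * (50 * (L * L))
  e₅ = solve-∀
  e₆ : ∀ m → 32 * (11 * (m * m)) + 9 * (m * m) ≡ (19 * m) * (19 * m)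
  e₆ = solve-∀
  40L≤19m : 40 * L ℕ.≤ 19 * m
  40L≤19m = ℕP.≮⇒≥ λ 19m<40L → ℕP.<-irrefl refl (begin-strict
    (19 * m) * (19 * m)                 <⟨ ℕP.*-mono-< 19m<40L 19m<40L ⟩
    (40 * L) * (40 * L)                 ≡⟨ e₅ L ⟩
    32 * (50 * (L * L))                 ≤⟨ ℕP.*-monoʳ-≤ 32 50L²≤ ⟩
    32 * (11 * (m * m))                 ≤⟨ ℕP.m≤m+n _ (9 * (m * m)) ⟩
    32 * (11 * (m * m)) + 9 * (m * m)   ≡⟨ e₆ m ⟩
    (19 * m) * (19 * m)                 ∎)

-- r ≈ 2n/m keeps a residue class below m/2 vertices, and p ≈ √(m/2) makes two segments of
-- length p r share r p² ≥ n free edges.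
minor-parameters : ∀ {n q m t} → q + m ≡ n → 1 ℕ.≤ n → 1 ℕ.≤ t →
  256 * (n * n * n) ℕ.≤ m * m * m * m → 25 * t * t * (n * n * n) ℕ.≤ m * m * m * m →
  ∃[ r ] ∃[ p ] ∃[ ℓ ] (suc ℓ ≡ t * (p * suc r) × suc q ℕ.≤ p * suc r * p
                        × suc q + suc ℓ + suc (n / suc r) ℕ.≤ n)
minor-parameters {n@(suc _)} {q} {zero} {t@(suc _)} q+m≡n 1≤n 1≤t ()
minor-parameters {n@(suc _)} {q} {m@(suc _)} {t@(suc _)} q+m≡n 1≤n 1≤t large many with square-root m
... | k , 2k²≤m , m<2p² = 2 * n / m , p , ℕ.pred L , ℕP.suc-pred L , wide , room
  where
  open ℕP.≤-Reasoning
  r = suc (2 * n / m)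
  p = suc k
  L = t * (p * r)
  2n≤rm : 2 * n ℕ.≤ r * m
  2n≤rm = begin
    2 * n                              ≡⟨ m≡m%n+[m/n]*n (2 * n) m ⟩
    2 * n % m + 2 * n / m * m          ≤⟨ ℕP.+-monoˡ-≤ _ (ℕP.<⇒≤ (m%n<n (2 * n) m)) ⟩
    r * m                              ∎
  m≤n : m ℕ.≤ n
  m≤n = subst (m ℕ.≤_) q+m≡n (ℕP.m≤n+m m q)
  -- Rounding 2n/m up costs at most one further m ≤ n; the factor 3 squares to the 9 in `budget`.
  rm≤3n : r * m ℕ.≤ 3 * n
  rm≤3n = ℕP.+-mono-≤ m≤n (m/n*n≤m (2 * n) m)
  252≤m : 252 ℕ.≤ m
  252≤m = slack-≥252 1≤n m≤n large
  wide : suc q ℕ.≤ p * r * p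
  wide = ℕP.≤-trans
    (subst (suc q ℕ.≤_) q+m≡n (ℕP.≤-trans (ℕP.≤-reflexive (ℕP.+-comm 1 q)) (ℕP.+-monoʳ-≤ q (ℕP.≤-trans (ℕP.m≤m+n 1 251) 252≤m))))
    (ℕP.*-cancelˡ-≤ 2 (begin
      2 * n                  ≤⟨ 2n≤rm ⟩
      r * m                  ≤⟨ ℕP.*-monoʳ-≤ r (ℕP.<⇒≤ m<2p²) ⟩
      r * (2 * (p * p))      ≡⟨ regroup r p ⟩
      2 * (p * r * p)        ∎))
    where
    regroup : ∀ r p → r * (2 * (p * p)) ≡ 2 * (p * r * p)
    regroup = solve-∀
  Lm≤ : L * m ℕ.≤ 3 * (t * p * n)
  Lm≤ = begin
    t * (p * r) * m       ≡⟨ regroup t p r m ⟩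
    t * p * (r * m)       ≤⟨ ℕP.*-monoʳ-≤ (t * p) rm≤3n ⟩
    t * p * (3 * n)       ≡⟨ regroup′ (t * p) n ⟩
    3 * (t * p * n)       ∎
    where
    regroup : ∀ t p r m → t * (p * r) * m ≡ t * p * (r * m)
    regroup = solve-∀
    regroup′ : ∀ a n → a * (3 * n) ≡ 3 * (a * n)
    regroup′ = solve-∀
  -- Squaring `Lm≤` produces t², and `many` turns 25 t² n³ into m⁴; then m ≤ n lets one factor m be
  -- replaced by n, which cancels.
  budget : 25 * (L * L) ℕ.≤ 9 * (p * p) * m
  budget = ℕP.*-cancelʳ-≤ _ _ (n * m * m) (begin
    25 * (L * L) * (n * m * m)                        ≡⟨ e₁ L n m ⟩
    25 * n * ((L * m) * (L * m))                      ≤⟨ ℕP.*-monoʳ-≤ (25 * n) (ℕP.*-mono-≤ Lm≤ Lm≤) ⟩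
    25 * n * (3 * (t * p * n) * (3 * (t * p * n)))    ≡⟨ e₂ t p n ⟩
    9 * (p * p) * (25 * t * t * (n * n * n))          ≤⟨ ℕP.*-monoʳ-≤ (9 * (p * p)) many ⟩
    9 * (p * p) * (m * m * m * m)                     ≡⟨ e₃ (9 * (p * p)) m ⟩
    9 * (p * p) * m * (m * m * m)                     ≤⟨ ℕP.*-monoʳ-≤ (9 * (p * p) * m) (ℕP.*-monoˡ-≤ m (ℕP.*-monoˡ-≤ m m≤n)) ⟩
    9 * (p * p) * m * (n * m * m)                     ∎)
    where
    e₁ : ∀ L n m → 25 * (L * L) * (n * m * m) ≡ 25 * n * ((L * m) * (L * m))
    e₁ = solve-∀
    e₂ : ∀ t p n → 25 * n * (3 * (t * p * n) * (3 * (t * p * n))) ≡ 9 * (p * p) * (25 * t * t * (n * n * n))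
    e₂ = solve-∀
    e₃ : ∀ a m → a * (m * m * m * m) ≡ a * m * (m * m * m)
    e₃ = solve-∀
  2[n/r]≤m : 2 * (n / r) ℕ.≤ m
  2[n/r]≤m = ℕP.*-cancelʳ-≤ _ _ r (begin
    2 * (n / r) * r      ≡⟨ ℕP.*-assoc 2 (n / r) r ⟩
    2 * (n / r * r)      ≤⟨ ℕP.*-monoʳ-≤ 2 (m/n*n≤m n r) ⟩
    2 * n                ≤⟨ 2n≤rm ⟩
    r * m                ≡⟨ ℕP.*-comm r m ⟩
    m * r                ∎)
  room : suc q + suc (ℕ.pred L) + suc (n / r) ℕ.≤ n
  room = ℕP.*-cancelˡ-≤ 2 (begin
    2 * (suc q + suc (ℕ.pred L) + suc (n / r))   ≡⟨ cong (λ l → 2 * (suc q + l + suc (n / r))) (ℕP.suc-pred L) ⟩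
    2 * (suc q + L + suc (n / r))                ≡⟨ regroup q L (n / r) ⟩
    2 * q + ((2 * L + 4) + 2 * (n / r))          ≤⟨ ℕP.+-monoʳ-≤ (2 * q) (ℕP.+-mono-≤ (branch-budget {k} {m} {L} 252≤m 2k²≤m budget) 2[n/r]≤m) ⟩
    2 * q + (m + m)                              ≡⟨ regroup′ q m ⟩
    2 * (q + m)                                  ≡⟨ cong (2 *_) q+m≡n ⟩
    2 * n                                        ∎)
    where
    regroup : ∀ q L x → 2 * (suc q + L + suc x) ≡ 2 * q + ((2 * L + 4) + 2 * x)
    regroup = solve-∀
    regroup′ : ∀ q m → 2 * q + (m + m) ≡ 2 * (q + m)
    regroup′ = solve-∀

-- With d = g + 1 and (n + d)² ≤ 2n² + 2d², doubling reduces the claim to 8n² + 8d² < 2d³: one d³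
-- pays for 8n² strictly, as g < d, and the other for 8d², as d ≥ 8.
surplus-bound : ∀ n g → 8 ℕ.≤ n → 8 * (n * n) ℕ.≤ g * g * g →
  2 * (n + suc g) * (n + suc g) ℕ.< suc g * suc g * suc g
surplus-bound n g 8≤n 8n²≤g³ = ℕP.*-cancelˡ-< 2 _ _ (begin-strict
  2 * (2 * (n + d) * (n + d))                       ≡⟨ expand n d ⟩
  4 * (n * n + d * d) + 4 * (2 * (n * d))           ≤⟨ ℕP.+-monoʳ-≤ (4 * (n * n + d * d)) (ℕP.*-monoʳ-≤ 4 (2ab≤a²+b² n d)) ⟩
  4 * (n * n + d * d) + 4 * (n * n + d * d)         ≡⟨ collect (n * n) (d * d) ⟩
  8 * (n * n) + 8 * (d * d)                         ≤⟨ ℕP.+-mono-≤ 8n²≤g³ (ℕP.*-monoˡ-≤ (d * d) 8≤d) ⟩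
  g * g * g + d * (d * d)                           <⟨ ℕP.+-monoˡ-< (d * (d * d)) (ℕP.*-mono-< (ℕP.*-mono-< (ℕP.n<1+n g) (ℕP.n<1+n g)) (ℕP.n<1+n g)) ⟩
  d * d * d + d * (d * d)                           ≡⟨ twice d ⟩
  2 * (d * d * d)                                   ∎)
  where
  open ℕP.≤-Reasoning
  d = suc g
  expand : ∀ n d → 2 * (2 * (n + d) * (n + d)) ≡ 4 * (n * n + d * d) + 4 * (2 * (n * d))
  expand = solve-∀
  collect : ∀ a b → 4 * (a + b) + 4 * (a + b) ≡ 8 * a + 8 * b
  collect = solve-∀
  twice : ∀ d → d * d * d + d * (d * d) ≡ 2 * (d * d * d)
  twice = solve-∀
  8≤d : 8 ℕ.≤ d
  -- If d < 8, then g³ ≤ 7³ = 343, while 8n² is at least 512 = 343 + 169.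
  8≤d = ℕP.≮⇒≥ λ { (s≤s g<7) → ℕP.<⇒≱ (ℕP.≤-<-trans (cube (ℕP.≤-trans (ℕP.n≤1+n g) g<7)) (ℕP.m<m+n 343 {169} (s≤s z≤n)))
      (ℕP.≤-trans (ℕP.*-monoʳ-≤ 8 (ℕP.*-mono-≤ 8≤n 8≤n)) 8n²≤g³) }
    where
    cube : g ℕ.≤ 7 → g * g * g ℕ.≤ 343
    cube g≤7 = ℕP.*-mono-≤ (ℕP.*-mono-≤ g≤7 g≤7) g≤7

-- From rational hypotheses to inequalities between natural numbers

toℚᵘ-ℕ→ℚ : ∀ k → ℚ.toℚᵘ (ℕ→ℚ k) ℚᵘ.≃ mkℚᵘ (ℤ.+ k) 0
toℚᵘ-ℕ→ℚ k = ℚP.toℚᵘ-fromℚᵘ (mkℚᵘ (ℤ.+ k) 0)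

-- Checked on unnormalised fractions with denominator 1, because `ℕ→ℚ` of a variable is stuck on a
-- gcd.
ℕ→ℚ-+ : ∀ a b → ℕ→ℚ (a + b) ≡ ℕ→ℚ a ℚ.+ ℕ→ℚ b
ℕ→ℚ-+ a b = ℚP.toℚᵘ-injective (begin
  ℚ.toℚᵘ (ℕ→ℚ (a + b))                         ≈⟨ toℚᵘ-ℕ→ℚ (a + b) ⟩
  mkℚᵘ (ℤ.+ (a + b)) 0                           ≈⟨ *≡* (cong (ℤ._* (ℤ.+ 1)) (trans (ℤP.pos-+ a b) (cong₂ ℤ._+_ (sym (ℤP.*-identityʳ (ℤ.+ a))) (sym (ℤP.*-identityʳ (ℤ.+ b)))))) ⟩
  mkℚᵘ (ℤ.+ a) 0 ℚᵘ.+ mkℚᵘ (ℤ.+ b) 0               ≈⟨ ℚᵘP.+-cong (toℚᵘ-ℕ→ℚ a) (toℚᵘ-ℕ→ℚ b) ⟨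
  ℚ.toℚᵘ (ℕ→ℚ a) ℚᵘ.+ ℚ.toℚᵘ (ℕ→ℚ b)           ≈⟨ ℚP.toℚᵘ-homo-+ (ℕ→ℚ a) (ℕ→ℚ b) ⟨
  ℚ.toℚᵘ (ℕ→ℚ a ℚ.+ ℕ→ℚ b)                     ∎)
  where open ℚᵘP.≃-Reasoning

ℕ→ℚ-* : ∀ a b → ℕ→ℚ (a * b) ≡ ℕ→ℚ a ℚ.* ℕ→ℚ b
ℕ→ℚ-* a b = ℚP.toℚᵘ-injective (begin
  ℚ.toℚᵘ (ℕ→ℚ (a * b))                         ≈⟨ toℚᵘ-ℕ→ℚ (a * b) ⟩
  mkℚᵘ (ℤ.+ (a * b)) 0                           ≈⟨ *≡* (cong (ℤ._* (ℤ.+ 1)) (ℤP.pos-* a b)) ⟩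
  mkℚᵘ (ℤ.+ a) 0 ℚᵘ.* mkℚᵘ (ℤ.+ b) 0               ≈⟨ ℚᵘP.*-cong (toℚᵘ-ℕ→ℚ a) (toℚᵘ-ℕ→ℚ b) ⟨
  ℚ.toℚᵘ (ℕ→ℚ a) ℚᵘ.* ℚ.toℚᵘ (ℕ→ℚ b)           ≈⟨ ℚP.toℚᵘ-homo-* (ℕ→ℚ a) (ℕ→ℚ b) ⟨
  ℚ.toℚᵘ (ℕ→ℚ a ℚ.* ℕ→ℚ b)                     ∎)
  where open ℚᵘP.≃-Reasoning

ℕ→ℚ-cancel-≤ : ∀ {a b} → ℕ→ℚ a ℚ.≤ ℕ→ℚ b → a ℕ.≤ b
ℕ→ℚ-cancel-≤ {a} {b} a≤b with ℚᵘP.≤-respʳ-≃ (toℚᵘ-ℕ→ℚ b) (ℚᵘP.≤-respˡ-≃ (toℚᵘ-ℕ→ℚ a) (ℚP.toℚᵘ-mono-≤ a≤b))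
... | *≤* le = ℤP.drop‿+≤+ (subst₂ ℤ._≤_ (ℤP.*-identityʳ (ℤ.+ a)) (ℤP.*-identityʳ (ℤ.+ b)) le)

ℕ→ℚ-mono-≤ : ∀ {a b} → a ℕ.≤ b → ℕ→ℚ a ℚ.≤ ℕ→ℚ b
ℕ→ℚ-mono-≤ {a} {b} a≤b = ℚP.toℚᵘ-cancel-≤
  (ℚᵘP.≤-respʳ-≃ (ℚᵘP.≃-sym (toℚᵘ-ℕ→ℚ b)) (ℚᵘP.≤-respˡ-≃ (ℚᵘP.≃-sym (toℚᵘ-ℕ→ℚ a))
    (*≤* (subst₂ ℤ._≤_ (sym (ℤP.*-identityʳ (ℤ.+ a))) (sym (ℤP.*-identityʳ (ℤ.+ b))) (ℤ.+≤+ a≤b)))))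

ℕ→ℚ-nonNeg : ∀ a → 0ℚ ℚ.≤ ℕ→ℚ a
ℕ→ℚ-nonNeg a = ℕ→ℚ-mono-≤ {0} {a} z≤n

*-mono-≤ : ∀ {a b c d} → 0ℚ ℚ.≤ a → 0ℚ ℚ.≤ c → a ℚ.≤ b → c ℚ.≤ d → a ℚ.* c ℚ.≤ b ℚ.* d
*-mono-≤ {a} {b} {c} {d} 0≤a 0≤c a≤b c≤d = ℚP.≤-trans
  (ℚP.*-monoʳ-≤-nonNeg c {{ℚ.nonNegative 0≤c}} a≤b)
  (ℚP.*-monoˡ-≤-nonNeg b {{ℚ.nonNegative (ℚP.≤-trans 0≤a a≤b)}} c≤d)

*-nonNeg : ∀ {a b} → 0ℚ ℚ.≤ a → 0ℚ ℚ.≤ b → 0ℚ ℚ.≤ a ℚ.* b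
*-nonNeg {a} {b} 0≤a 0≤b = subst (ℚ._≤ a ℚ.* b) (ℚP.*-zeroˡ 0ℚ) (*-mono-≤ ℚP.≤-refl ℚP.≤-refl 0≤a 0≤b)

module _ where
  open ℚSolver.+-*-Solver

  epsilon-slack : ∀ {ε n q} → 0ℚ ℚ.≤ ε → ℕ→ℚ q ℚ.≤ (1ℚ ℚ.- ε) ℚ.* ℕ→ℚ n →
                  ∃[ m ] (q + m ≡ n × ε ℚ.* ℕ→ℚ n ℚ.≤ ℕ→ℚ m)
  epsilon-slack {ε} {n} {q} 0≤ε q≤ = n ∸ q , q+m≡n , (begin
    ε ℚ.* ℕ→ℚ n                                    ≡⟨ solve 3 (λ e n q → e :* n := (q :+ e :* n) :- q) refl ε (ℕ→ℚ n) (ℕ→ℚ q) ⟩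
    (ℕ→ℚ q ℚ.+ ε ℚ.* ℕ→ℚ n) ℚ.- ℕ→ℚ q              ≤⟨ ℚP.+-monoˡ-≤ (ℚ.- ℕ→ℚ q) q+εn≤n ⟩
    ℕ→ℚ n ℚ.- ℕ→ℚ q                                ≡⟨ cong (λ k → ℕ→ℚ k ℚ.- ℕ→ℚ q) q+m≡n ⟨
    ℕ→ℚ (q + (n ∸ q)) ℚ.- ℕ→ℚ q                    ≡⟨ cong (ℚ._- ℕ→ℚ q) (ℕ→ℚ-+ q (n ∸ q)) ⟩
    (ℕ→ℚ q ℚ.+ ℕ→ℚ (n ∸ q)) ℚ.- ℕ→ℚ q              ≡⟨ solve 2 (λ q m → (q :+ m) :- q := m) refl (ℕ→ℚ q) (ℕ→ℚ (n ∸ q)) ⟩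
    ℕ→ℚ (n ∸ q)                                    ∎)
    where
    open ℚP.≤-Reasoning
    q+εn≤n : ℕ→ℚ q ℚ.+ ε ℚ.* ℕ→ℚ n ℚ.≤ ℕ→ℚ n
    q+εn≤n = begin
      ℕ→ℚ q ℚ.+ ε ℚ.* ℕ→ℚ n                          ≤⟨ ℚP.+-monoˡ-≤ (ε ℚ.* ℕ→ℚ n) q≤ ⟩
      (1ℚ ℚ.- ε) ℚ.* ℕ→ℚ n ℚ.+ ε ℚ.* ℕ→ℚ n           ≡⟨ solve 2 (λ e n → (con 1ℚ :- e) :* n :+ e :* n := n) refl ε (ℕ→ℚ n) ⟩
      ℕ→ℚ n                                          ∎
    q≤n : q ℕ.≤ n
    q≤n = ℕ→ℚ-cancel-≤ (begin
      ℕ→ℚ q                          ≡⟨ ℚP.+-identityʳ (ℕ→ℚ q) ⟨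
      ℕ→ℚ q ℚ.+ 0ℚ                   ≤⟨ ℚP.+-monoʳ-≤ (ℕ→ℚ q) (*-nonNeg 0≤ε (ℕ→ℚ-nonNeg n)) ⟩
      ℕ→ℚ q ℚ.+ ε ℚ.* ℕ→ℚ n          ≤⟨ q+εn≤n ⟩
      ℕ→ℚ n                          ∎)
    q+m≡n : q + (n ∸ q) ≡ n
    q+m≡n = ℕP.m+[n∸m]≡n q≤n

  -- Multiplication by n³ turns ε⁴n into (εn)⁴, which eliminates ε in favour of the natural number
  -- `m`.
  fourth-power-bound : ∀ {ε n m A} → 0ℚ ℚ.≤ ε → ε ℚ.* ℕ→ℚ n ℚ.≤ ℕ→ℚ m →
    ℕ→ℚ A ℚ.≤ ε ℚ.* ε ℚ.* ε ℚ.* ε ℚ.* ℕ→ℚ n → A * (n * n * n) ℕ.≤ m * m * m * m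
  fourth-power-bound {ε} {n} {m} {A} 0≤ε εn≤m A≤ = ℕ→ℚ-cancel-≤ (begin
    ℕ→ℚ (A * (n * n * n))
      ≡⟨ trans (ℕ→ℚ-* A (n * n * n)) (cong (ℕ→ℚ A ℚ.*_) (trans (ℕ→ℚ-* (n * n) n) (cong (ℚ._* N) (ℕ→ℚ-* n n)))) ⟩
    ℕ→ℚ A ℚ.* (N ℚ.* N ℚ.* N)
      ≤⟨ ℚP.*-monoʳ-≤-nonNeg (N ℚ.* N ℚ.* N) {{ℚ.nonNegative (*-nonNeg (*-nonNeg 0≤N 0≤N) 0≤N)}} A≤ ⟩
    ε ℚ.* ε ℚ.* ε ℚ.* ε ℚ.* N ℚ.* (N ℚ.* N ℚ.* N)
      ≡⟨ solve 2 (λ e n → e :* e :* e :* e :* n :* (n :* n :* n) := (e :* n) :* (e :* n) :* (e :* n) :* (e :* n)) refl ε N ⟩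
    x ℚ.* x ℚ.* x ℚ.* x
      ≤⟨ *-mono-≤ (*-nonNeg (*-nonNeg 0≤x 0≤x) 0≤x) 0≤x (*-mono-≤ (*-nonNeg 0≤x 0≤x) 0≤x (*-mono-≤ 0≤x 0≤x εn≤m εn≤m) εn≤m) εn≤m ⟩
    ℕ→ℚ m ℚ.* ℕ→ℚ m ℚ.* ℕ→ℚ m ℚ.* ℕ→ℚ m
      ≡⟨ trans (ℕ→ℚ-* (m * m * m) m) (cong (ℚ._* ℕ→ℚ m) (trans (ℕ→ℚ-* (m * m) m) (cong (ℚ._* ℕ→ℚ m) (ℕ→ℚ-* m m)))) ⟨
    ℕ→ℚ (m * m * m * m) ∎)
    where
    open ℚP.≤-Reasoning
    N x : ℚ
    N = ℕ→ℚ n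
    x = ε ℚ.* N
    0≤N : 0ℚ ℚ.≤ N
    0≤N = ℕ→ℚ-nonNeg n
    0≤x : 0ℚ ℚ.≤ x
    0≤x = *-nonNeg 0≤ε 0≤N

  0≤1/ : ∀ k → 0ℚ ℚ.≤ (ℤ.+ 1 ℚ./ suc k)
  0≤1/ k = ℚP.toℚᵘ-cancel-≤ (ℚᵘP.≤-respʳ-≃ (ℚᵘP.≃-sym (ℚP.toℚᵘ-fromℚᵘ (mkℚᵘ (ℤ.+ 1) k))) (*≤* (ℤ.+≤+ z≤n)))

  1/-antimono-≤ : ∀ {j k} → j ℕ.≤ k → (ℤ.+ 1 ℚ./ suc k) ℚ.≤ (ℤ.+ 1 ℚ./ suc j)
  1/-antimono-≤ {j} {k} j≤k = ℚP.toℚᵘ-cancel-≤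
    (ℚᵘP.≤-respˡ-≃ (ℚᵘP.≃-sym (ℚP.toℚᵘ-fromℚᵘ (mkℚᵘ (ℤ.+ 1) k)))
      (ℚᵘP.≤-respʳ-≃ (ℚᵘP.≃-sym (ℚP.toℚᵘ-fromℚᵘ (mkℚᵘ (ℤ.+ 1) j)))
        (*≤* (ℤ.+≤+ (ℕP.+-monoˡ-≤ 0 (s≤s j≤k))))))

  two : ℚ
  two = ℕ→ℚ 2

  expTerm-nonNeg : ∀ k → 0ℚ ℚ.≤ expTerm two k
  expTerm-nonNeg zero    = ℕ→ℚ-nonNeg 1
  expTerm-nonNeg (suc k) = *-nonNeg (*-nonNeg (expTerm-nonNeg k) (ℕ→ℚ-nonNeg 2)) (0≤1/ k)

  -- The ratio of the two terms is 2/(k + 4), at most 1/2.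
  expTerm-halves : ∀ k → expTerm two (4 + k) ℚ.+ expTerm two (4 + k) ℚ.≤ expTerm two (3 + k)
  expTerm-halves k = begin
    T ℚ.* two ℚ.* c ℚ.+ T ℚ.* two ℚ.* c     ≡⟨ solve 2 (λ T c → T :* con two :* c :+ T :* con two :* c := T :* (con (ℕ→ℚ 4) :* c)) refl T c ⟩
    T ℚ.* (ℕ→ℚ 4 ℚ.* c)                     ≤⟨ ℚP.*-monoˡ-≤-nonNeg T {{ℚ.nonNegative (expTerm-nonNeg (3 + k))}}
                                                 (ℚP.*-monoˡ-≤-nonNeg (ℕ→ℚ 4) (1/-antimono-≤ (ℕP.m≤m+n 3 k))) ⟩
    T ℚ.* 1ℚ                                ≡⟨ ℚP.*-identityʳ T ⟩
    T                                       ∎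
    where
    open ℚP.≤-Reasoning
    T c : ℚ
    T = expTerm two (3 + k)
    c = ℤ.+ 1 ℚ./ (4 + k)

  -- S_K + T_K, a partial sum plus its last term, is nonincreasing once the terms halve.
  expPartial-tail : ∀ k → expPartial two (3 + k) ℚ.+ expTerm two (3 + k) ℚ.≤ ℕ→ℚ 8
  -- 1 + 2 + 2 + 4/3 + 4/3 = 23/3, just below 24/3.
  expPartial-tail zero    = ℚ.*≤* (ℤ.+≤+ (ℕP.m≤m+n 23 1))
  expPartial-tail (suc k) = begin
    S ℚ.+ T ℚ.+ T                  ≡⟨ ℚP.+-assoc S T T ⟩
    S ℚ.+ (T ℚ.+ T)                ≤⟨ ℚP.+-monoʳ-≤ S (expTerm-halves k) ⟩
    S ℚ.+ expTerm two (3 + k)      ≤⟨ expPartial-tail k ⟩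
    ℕ→ℚ 8                          ∎
    where
    open ℚP.≤-Reasoning
    S T : ℚ
    S = expPartial two (3 + k)
    T = expTerm two (4 + k)

  expPartial-mono : ∀ k → expPartial two k ℚ.≤ expPartial two (suc k)
  expPartial-mono k = subst (ℚ._≤ expPartial two (suc k)) (ℚP.+-identityʳ _)
    (ℚP.+-monoʳ-≤ (expPartial two k) (expTerm-nonNeg (suc k)))

  -- Makes r = 2 admissible in `LogBound` for every n ≥ 8. By monotonicity the index may be raised
  -- by 3, into the range where the terms halve.
  expPartial-two≤8 : ∀ k → expPartial two k ℚ.≤ ℕ→ℚ 8
  expPartial-two≤8 k = ℚP.≤-trans (expPartial-mono k)
    (ℚP.≤-trans (expPartial-mono (suc k)) (ℚP.≤-trans (expPartial-mono (2 + k))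
      (ℚP.≤-trans (subst (ℚ._≤ expPartial two (3 + k) ℚ.+ expTerm two (3 + k)) (ℚP.+-identityʳ _)
        (ℚP.+-monoʳ-≤ (expPartial two (3 + k)) (expTerm-nonNeg (3 + k)))) (expPartial-tail k))))

  log-surplus : ∀ {n η q} → 8 ℕ.≤ n → LogBound n η → ℕ→ℚ n ℚ.+ η ℚ.≤ ℕ→ℚ q →
                ∃[ g ] (q ≡ n + g × 8 * (n * n) ℕ.≤ g * g * g)
  log-surplus {n} {η} {q} 8≤n (0≤η , log) n+η≤q = q ∸ n , sym n+g≡q , ℕ→ℚ-cancel-≤ (begin
    ℕ→ℚ (8 * (n * n))                        ≡⟨ ℕ→ℚ-* 8 (n * n) ⟩
    -- The logarithmic bound at r = 2; the factor 8 is 2³.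
    two ℚ.* two ℚ.* two ℚ.* ℕ→ℚ (n * n)      ≤⟨ log two (ℕ→ℚ-nonNeg 2) (λ K → ℚP.≤-trans (expPartial-two≤8 K) (ℕ→ℚ-mono-≤ 8≤n)) ⟩
    η ℚ.* η ℚ.* η                            ≤⟨ *-mono-≤ (*-nonNeg 0≤η 0≤η) 0≤η (*-mono-≤ 0≤η 0≤η η≤g η≤g) η≤g ⟩
    ℕ→ℚ g ℚ.* ℕ→ℚ g ℚ.* ℕ→ℚ g                ≡⟨ trans (ℕ→ℚ-* (g * g) g) (cong (ℚ._* ℕ→ℚ g) (ℕ→ℚ-* g g)) ⟨
    ℕ→ℚ (g * g * g)                          ∎)
    where
    open ℚP.≤-Reasoning
    g : ℕ
    g = q ∸ n
    n≤q : n ℕ.≤ q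
    n≤q = ℕ→ℚ-cancel-≤ (ℚP.≤-trans (subst (ℚ._≤ ℕ→ℚ n ℚ.+ η) (ℚP.+-identityʳ _) (ℚP.+-monoʳ-≤ (ℕ→ℚ n) 0≤η)) n+η≤q)
    n+g≡q : n + g ≡ q
    n+g≡q = ℕP.m+[n∸m]≡n n≤q
    η≤g : η ℚ.≤ ℕ→ℚ g
    η≤g = begin
      η                                        ≡⟨ solve 2 (λ n e → e := (n :+ e) :- n) refl (ℕ→ℚ n) η ⟩
      (ℕ→ℚ n ℚ.+ η) ℚ.- ℕ→ℚ n                  ≤⟨ ℚP.+-monoˡ-≤ (ℚ.- ℕ→ℚ n) n+η≤q ⟩
      ℕ→ℚ q ℚ.- ℕ→ℚ n                          ≡⟨ cong (λ k → ℕ→ℚ k ℚ.- ℕ→ℚ n) n+g≡q ⟨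
      ℕ→ℚ (n + g) ℚ.- ℕ→ℚ n                    ≡⟨ cong (ℚ._- ℕ→ℚ n) (ℕ→ℚ-+ n g) ⟩
      (ℕ→ℚ n ℚ.+ ℕ→ℚ g) ℚ.- ℕ→ℚ n              ≡⟨ solve 2 (λ n g → (n :+ g) :- n := g) refl (ℕ→ℚ n) (ℕ→ℚ g) ⟩
      ℕ→ℚ g                                    ∎

-- Roots are cleared: ε ≥ 4 n^(-1/4) reads 256 ≤ ε⁴n, and t ≤ ε²√n/5 reads 25t² ≤ ε⁴n.
theorem1p1 : ∃[ n₀ ] ((n : ℕ) → n₀ ℕ.≤ n →
    ((ε : ℚ) → ℚ.0ℚ ℚ.≤ ε → ℕ→ℚ 256 ℚ.≤ ε ℚ.* ε ℚ.* ε ℚ.* ε ℚ.* ℕ→ℚ n →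
    (t : ℕ) → 1 ℕ.≤ t → ℕ→ℚ (25 ℕ.* t ℕ.* t) ℚ.≤ ε ℚ.* ε ℚ.* ε ℚ.* ε ℚ.* ℕ→ℚ n →
    (q : ℕ) → 1 ℕ.≤ q → ℕ→ℚ q ℚ.≤ (ℚ.1ℚ ℚ.- ε) ℚ.* ℕ→ℚ n →
    WaiterWins {n} q (HasMinor t) (allEdges n) [])
    ×
    ((η : ℚ) → LogBound n η →
    (q : ℕ) → 1 ℕ.≤ q → ℕ→ℚ n ℚ.+ η ℚ.≤ ℕ→ℚ q →
    ClientWins {n} q (λ C → ¬ HasMinor 4 C) (allEdges n) []))
theorem1p1 = 8 , λ n 8≤n → waiter n 8≤n , client n 8≤n
  where
  waiter : ∀ n → 8 ℕ.≤ n → ∀ ε → 0ℚ ℚ.≤ ε → ℕ→ℚ 256 ℚ.≤ ε ℚ.* ε ℚ.* ε ℚ.* ε ℚ.* ℕ→ℚ n →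
    ∀ t → 1 ℕ.≤ t → ℕ→ℚ (25 * t * t) ℚ.≤ ε ℚ.* ε ℚ.* ε ℚ.* ε ℚ.* ℕ→ℚ n →
    ∀ q → 1 ℕ.≤ q → ℕ→ℚ q ℚ.≤ (1ℚ ℚ.- ε) ℚ.* ℕ→ℚ n → WaiterWins {n} q (HasMinor t) (allEdges n) []
  waiter n 8≤n ε 0≤ε large t 1≤t many q _ q≤ =
    let m , q+m≡n , εn≤m = epsilon-slack {ε} {n} {q} 0≤ε q≤
        r , p , ℓ , sucℓ , wide , room = minor-parameters q+m≡n (ℕP.≤-trans (s≤s z≤n) 8≤n) 1≤t
          (fourth-power-bound {ε} {n} {m} {A = 256} 0≤ε εn≤m large) (fourth-power-bound {ε} {n} {m} {A = 25 * t * t} 0≤ε εn≤m many)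
    in waiter-forces-minor n q (suc r) p t ℓ sucℓ wide room
  client : ∀ n → 8 ℕ.≤ n → ∀ η → LogBound n η → ∀ q → 1 ℕ.≤ q → ℕ→ℚ n ℚ.+ η ℚ.≤ ℕ→ℚ q →
    ClientWins {n} q (λ C → ¬ HasMinor 4 C) (allEdges n) []
  client n 8≤n η log q _ n+η≤q =
    let g , q≡n+g , 8n²≤g³ = log-surplus {n} {η} {q} 8≤n log n+η≤q
    in client-keeps-K₄-minor-free n q (suc g) (trans (cong suc q≡n+g) (sym (ℕP.+-suc n g)))
         (surplus-bound n g 8≤n 8n²≤g³)
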